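{- Let $r_n:=|\mathfrak{A}_{2n+1}(2413,3142)|$, $R(x):=\sum_{n\ge1}r_nx^n$, $t_n:=|\mathfrak{A}_{2n}(2413,3142)|$ for $n\ge1$, and $T(x):=\sum_{n\ge1}t_nx^n$. Then $$\tfrac12R(x)=\tfrac12R(x)T(x)+T(x).$$ Consequently $t_1=1$ and for $n\ge2$, $$t_n=\frac{4}{n-1}\sum_{i=0}^{n-2}2^i\binom{2n-1}{i}\binom{n-1}{i+1}.$$
   Context: $\mathfrak{A}_m(2413,3142)$ is the set of permutations $\pi$ of $[m]$ that are alternating (up-down), i.e. $\pi(1)<\pi(2)>\pi(3)<\pi(4)>\cdots$, and avoid both classical patterns $2413$ and $3142$. -}

module Defs where

open import Data.Nat as ℕ using (ℕ; zero; suc; _∸_; _%_; _≤_; s≤s; NonZero)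
open import Data.Nat.Combinatorics using (_C_)
open import Data.Integer using (+_)
open import Data.Rational as ℚ using (ℚ; 0ℚ; _/_)
open import Data.Fin using (Fin; toℕ; _<_; #_)
open import Data.Fin.Properties using (_≟_; _<?_; all?; any?)
open import Data.Vec using (Vec; []; _∷_; lookup)
open import Data.Vec.Properties using (∷-injective)
open import Data.List as List using (List; filter; length; map; foldr; upTo; allFin; cartesianProductWith)
open import Data.List.Membership.Propositional using (_∈_; find; lose)
open import Data.List.Membership.Propositional.Properties using (∈-allFin; ∈-cartesianProductWith⁺; ∈-filter⁺; ∈-filter⁻)
open import Data.List.Relation.Unary.Any as Any using (here)
open import Data.List.Relation.Unary.AllPairs as AllPairs using ()
open import Data.List.Relation.Unary.All as All using ()
open import Data.List.Relation.Unary.Unique.Propositional using (Unique)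
import Data.List.Relation.Unary.Unique.Propositional.Properties as Unique
open import Data.Product using (∃; _×_; _,_; proj₁; proj₂)
open import Function using (_⇔_; mk⇔; Equivalence; Bijective; Injective; Surjective)
open import Relation.Binary.PropositionalEquality using (_≡_; refl; cong; trans)
open import Relation.Nullary using (¬_; Dec; ¬?)
open import Relation.Nullary.Decidable using (map′; _×-dec_; _→-dec_)

Word : ℕ → ℕ → Set
Word n k = Vec (Fin n) k

-- Positions and values are 0-based: the permutation π of [m] is the word
-- with  lookup w i = π(i+1) - 1.
IsPermutation : ∀ {m} → Word m m → Set
IsPermutation w = Bijective _≡_ _≡_ (lookup w)

-- The 0-based index i is the 1-based position i+1, so ascents start at
-- even i.
IsUpDown : ∀ {m} → Word m m → Set
IsUpDown w = ∀ i j → toℕ j ≡ suc (toℕ i) →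
  (toℕ i % 2 ≡ 0 → lookup w i < lookup w j) ×
  (toℕ i % 2 ≡ 1 → lookup w j < lookup w i)

IncreasingPositions : ∀ {m k} → Word m k → Set
IncreasingPositions p = ∀ a b → a < b → lookup p a < lookup p b

OccursAt : ∀ {m k} → Word k k → Word m m → Word m k → Set
OccursAt σ w p = IncreasingPositions p ×
  (∀ a b → lookup σ a < lookup σ b ⇔
           lookup w (lookup p a) < lookup w (lookup p b))

Contains : ∀ {m k} → Word m m → Word k k → Set
Contains w σ = ∃ λ p → OccursAt σ w p

Avoids : ∀ {m k} → Word m m → Word k k → Set
Avoids w σ = ¬ Contains w σ

p2413 : Word 4 4
p2413 = # 1 ∷ # 3 ∷ # 0 ∷ # 2 ∷ []

p3142 : Word 4 4
p3142 = # 2 ∷ # 0 ∷ # 3 ∷ # 1 ∷ []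

𝔄 : (m : ℕ) → Word m m → Set
𝔄 m w = IsPermutation w × IsUpDown w × Avoids w p2413 × Avoids w p3142

words : ∀ n k → List (Word n k)
words n zero    = [] List.∷ List.[]
words n (suc k) = cartesianProductWith _∷_ (allFin n) (words n k)

words-complete : ∀ {n k} (w : Word n k) → w ∈ words n k
words-complete []      = here refl
words-complete (x ∷ w) =
  ∈-cartesianProductWith⁺ _∷_ (∈-allFin x) (words-complete w)

words-unique : ∀ n k → Unique (words n k)
words-unique n zero    = All.[] AllPairs.∷ AllPairs.[]
words-unique n (suc k) =
  Unique.cartesianProductWith⁺ _∷_ ∷-injective (Unique.allFin⁺ n) (words-unique n k)

isPermutation? : ∀ {m} (w : Word m m) → Dec (IsPermutation w)
isPermutation? w = injective? ×-dec surjective?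
  where
  injective? : Dec (Injective _≡_ _≡_ (lookup w))
  injective? = map′ (λ f {x} {y} → f x y) (λ f x y → f {x} {y})
    (all? λ x → all? λ y → (lookup w x ≟ lookup w y) →-dec (x ≟ y))
  surjective? : Dec (Surjective _≡_ _≡_ (lookup w))
  surjective? = all? λ y → map′
    (λ (x , e) → x , λ {z} z≡x → trans (cong (lookup w) z≡x) e)
    (λ (x , e) → x , e refl)
    (any? λ x → lookup w x ≟ y)

isUpDown? : ∀ {m} (w : Word m m) → Dec (IsUpDown w)
isUpDown? w = all? λ i → all? λ j → (toℕ j ℕ.≟ suc (toℕ i)) →-dec
  (((toℕ i % 2 ℕ.≟ 0) →-dec (lookup w i <? lookup w j)) ×-dec
   ((toℕ i % 2 ℕ.≟ 1) →-dec (lookup w j <? lookup w i)))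

occursAt? : ∀ {m k} (σ : Word k k) (w : Word m m) (p : Word m k) → Dec (OccursAt σ w p)
occursAt? σ w p =
  (all? λ a → all? λ b → (a <? b) →-dec (lookup p a <? lookup p b)) ×-dec
  (all? λ a → all? λ b →
    let s? = lookup σ a <? lookup σ b
        v? = lookup w (lookup p a) <? lookup w (lookup p b)
    in map′ (λ (f , g) → mk⇔ f g) (λ e → Equivalence.to e , Equivalence.from e)
         ((s? →-dec v?) ×-dec (v? →-dec s?)))

contains? : ∀ {m k} (w : Word m m) (σ : Word k k) → Dec (Contains w σ)
contains? {m} {k} w σ = map′
  (λ any → let (p , _ , o) = find any in p , o)
  (λ (p , o) → lose (words-complete p) o)
  (Any.any? (occursAt? σ w) (words m k))

𝔄? : ∀ m (w : Word m m) → Dec (𝔄 m w)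
𝔄? m w = isPermutation? w ×-dec isUpDown? w ×-dec
         ¬? (contains? w p2413) ×-dec ¬? (contains? w p3142)

𝔄-list : ∀ m → List (Word m m)
𝔄-list m = filter (𝔄? m) (words m m)

-- 𝔄-list m lists exactly the elements of 𝔄 m, each once, so its length is
-- the cardinality of 𝔄 m.
∈-𝔄-list : ∀ {m} (w : Word m m) → w ∈ 𝔄-list m ⇔ 𝔄 m w
∈-𝔄-list {m} w = mk⇔
  (λ w∈ → proj₂ (∈-filter⁻ (𝔄? m) {xs = words m m} w∈))
  (∈-filter⁺ (𝔄? m) (words-complete w))

𝔄-list-unique : ∀ m → Unique (𝔄-list m)
𝔄-list-unique m = Unique.filter⁺ (𝔄? m) (words-unique m m)

∣𝔄∣ : ℕ → ℕ
∣𝔄∣ m = length (𝔄-list m)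

r : ℕ → ℕ
r n = ∣𝔄∣ (2 ℕ.* n ℕ.+ 1)

t : ℕ → ℕ
t n = ∣𝔄∣ (2 ℕ.* n)

fromℕ : ℕ → ℚ
fromℕ n = + n / 1

-- ∑[ N ] f  =  f 0 + f 1 + ⋯ + f N   (upper limit included)
∑[_]_ : ℕ → (ℕ → ℚ) → ℚ
∑[ N ] f = foldr ℚ._+_ 0ℚ (map f (upTo (suc N)))

PowerSeries : Set
PowerSeries = ℕ → ℚ

infix  4 _≈_
infixl 6 _⊕_
infixl 7 _⊗_
infixr 7 _·_

_≈_ : PowerSeries → PowerSeries → Set
F ≈ G = ∀ n → F n ≡ G n

_⊕_ : PowerSeries → PowerSeries → PowerSeries
(F ⊕ G) n = F n ℚ.+ G n

_·_ : ℚ → PowerSeries → PowerSeries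
(c · F) n = c ℚ.* F n

_⊗_ : PowerSeries → PowerSeries → PowerSeries
(F ⊗ G) n = ∑[ n ] (λ k → F k ℚ.* G (n ∸ k))

R : PowerSeries
R zero    = 0ℚ
R (suc n) = fromℕ (r (suc n))

T : PowerSeries
T zero    = 0ℚ
T (suc n) = fromℕ (t (suc n))

2≤n⇒n∸1≢0 : ∀ {n} → 2 ≤ n → NonZero (n ∸ 1)
2≤n⇒n∸1≢0 (s≤s (s≤s _)) = _

-- For n ≥ 2 the truncated subtractions are genuine.
closedForm : ∀ n → 2 ≤ n → ℚ
closedForm n 2≤n =
  (_/_ (+ 4) (n ∸ 1) {{2≤n⇒n∸1≢0 2≤n}}) ℚ.*
  (∑[ n ∸ 2 ] λ i →
    fromℕ (2 ℕ.^ i ℕ.* ((2 ℕ.* n ∸ 1) C i) ℕ.* ((n ∸ 1) C (i ℕ.+ 1))))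

{-# OPTIONS --safe #-}

-- A list of at least two distinct entries avoiding 2413 and 3142 splits as a
-- direct or a skew sum. Always cutting at the first possible place, one parses
-- an alternating separable list uniquely: let A be the class of the lists of odd
-- length and P that of the nonempty lists of even length that cannot be cut in
-- the direction of their first step, respectively in the opposite direction, L
-- the sequences of elements of P (all lists of even length) and O the class of
-- all lists of odd length. Up to complementation
--   O = A L,  P = A O,  A = z + P O,  L = 1 + P L,
-- where z is a single entry. Hence L = 1 + T, where T counts the nonempty lists
-- of even length, and T = P L = A O L = O². With x = z² and O = z S, this and
-- the expansion of A in O = A L give T = x S² and S = 1 + x (S² + S³), which
-- amounts to R = R T + 2 T for R = S - 1. Lagrange inversion for
-- S = 1 + w, w = x (1 + w)² (2 + w), yields the closed form.
module Submission where

open import Defs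
open import Data.Empty using (⊥; ⊥-elim)
open import Data.Fin as Fin using (Fin; zero; suc; toℕ; fromℕ<; #_)
open import Data.Fin.Properties as Fin using (toℕ<n; toℕ-injective; toℕ-fromℕ<)
open import Data.Integer as ℤ using () renaming (+_ to pos)
import Data.Integer.Properties as ℤ
open import Data.List as List using (List; []; _∷_; [_]; _++_; map; length; foldr; tabulate; applyUpTo)
open import Data.List.Membership.Propositional using (_∈_)
open import Data.List.Membership.Propositional.Properties
open import Data.List.Properties using (++-assoc; ++-identityʳ; ∷-injective; length-++; length-map; length-applyUpTo; map-applyUpTo; tabulate-lookup) renaming (tabulate-cong to tabulateᴸ-cong)
import Data.List.Relation.Binary.Sublist.Propositional.Properties as Sublist
open import Data.List.Relation.Binary.Sublist.Propositional as Sublist using (_⊆_; []; _∷_; _∷ʳ_; ⊆-trans; ⊆-refl; minimum; from∈)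
open import Data.List.Relation.Unary.All as All using (All; []; _∷_)
import Data.List.Relation.Unary.All.Properties as All
open import Data.List.Relation.Unary.AllPairs using ([]; _∷_)
open import Data.List.Relation.Unary.Any using (here; there)
open import Data.List.Relation.Unary.Unique.Propositional using (Unique)
import Data.List.Relation.Unary.Unique.Propositional.Properties as Unique
open import Data.Nat using (ℕ; zero; suc; pred; _+_; _*_; _∸_; _^_; _⊔_; _%_; _≤_; _<_; z≤n; s≤s; s≤s⁻¹)
open import Data.Nat.Combinatorics using (_C_; nCk+nC[k+1]≡[n+1]C[k+1]; k>n⇒nCk≡0)
import Data.Nat.Coprimality as Coprime
open import Data.Nat.Properties
open import Data.Nat.Tactic.RingSolver using (solve-∀)
open import Data.Product using (∃; ∃₂; _×_; _,_; proj₁; proj₂)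
open import Data.Rational as ℚ using (ℚ; ½; 0ℚ; 1ℚ; mkℚ; toℚᵘ)
import Data.Rational.Properties as ℚ
import Data.Rational.Unnormalised as ℚᵘ
import Data.Rational.Unnormalised.Properties as ℚᵘ
open import Data.Sum using (_⊎_; inj₁; inj₂)
open import Data.Unit using (⊤; tt)
open import Data.Vec as Vec using (Vec; []; _∷_; lookup; toList)
open import Data.Vec.Properties using (lookup-map; lookup∘tabulate; tabulate∘lookup; tabulate-cong; map-∘)
open import Function using (_∘_; id; _⇔_; mk⇔; Equivalence)
open import Relation.Binary using (tri<; tri≈; tri>)
open import Relation.Binary.PropositionalEquality hiding ([_])
open import Relation.Nullary using (¬_; yes; no; contradiction)

-- Forest numbers

-- The algebra of generating functions is replaced by counting forests. If B and L count the trees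
-- `Block` and `Chain` by weight, then A = z B and S = B L, and forests of `j` blocks and `k` chains
-- have the generating function B^j L^k. Opening the first tree of a forest either drops it or
-- exchanges it for its children; this gives a recursion without convolutions, at the price of
-- growing `j` and `k`. On the diagonal `j = k` it becomes a recurrence for the powers of S. Both
-- the product rule `conv-diag` and Lagrange inversion `diag-lagrange` are inductions along this
-- recurrence, lexicographic because `k` grows only when `n` drops. Everything stays in the natural
-- numbers, with subtracted terms moved across the equations. On the side of permutations the
-- obstacle is that the parts of a cut permutation are not permutations. Trees are therefore
-- interpreted as lists that occupy an interval of values at an arbitrary offset, and parsing keeps
-- track of this interval; no standardisation is ever performed.

exchange : ∀ a b c d → (a + b) + (c + d) ≡ (a + c) + (b + d)
exchange = solve-∀

-- The number of sequences of j blocks and k chains, as defined in the section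
-- on trees, with e constructors node and cons altogether.
forestCount : ℕ → ℕ → ℕ → ℕ
forestCount zero    zero    zero    = 1
forestCount zero    zero    (suc e) = 0
forestCount zero    (suc k) zero    = forestCount zero k zero
forestCount zero    (suc k) (suc e) =
  forestCount zero k (suc e) + forestCount 2 (2 + k) e
forestCount (suc j) k       zero    = forestCount j k zero
forestCount (suc j) k       (suc e) =
  forestCount j k (suc e) + forestCount (3 + j) (2 + k) e

forestCount-zero : ∀ j k → forestCount j k 0 ≡ 1
forestCount-zero zero    zero    = refl
forestCount-zero zero    (suc k) = forestCount-zero zero k
forestCount-zero (suc j) k       = forestCount-zero j k

-- The definition opens chains only when no block is left. Opening a block and opening a chain
-- commute, so by induction on `j` a chain may just as well be opened first; `exchange` swaps the
-- two mixed terms.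
forestCount-sucʳ : ∀ j k e →
  forestCount j (suc k) (suc e) ≡ forestCount j k (suc e) + forestCount (2 + j) (2 + k) e
forestCount-sucʳ zero    k e       = refl
forestCount-sucʳ (suc j) k zero
  rewrite forestCount-sucʳ j k 0
        | forestCount-zero j (2 + k) | forestCount-zero j (3 + k) = refl
forestCount-sucʳ (suc j) k (suc e) = begin
  forestCount j (suc k) (2 + e) + forestCount (3 + j) (3 + k) (suc e)
    ≡⟨ cong₂ _+_ (forestCount-sucʳ j k (suc e)) (forestCount-sucʳ (3 + j) (2 + k) e) ⟩
  (forestCount j k (2 + e) + forestCount (2 + j) (2 + k) (suc e))
    + (forestCount (3 + j) (2 + k) (suc e) + forestCount (5 + j) (4 + k) e)
    ≡⟨ exchange (forestCount j k (2 + e)) (forestCount (2 + j) (2 + k) (suc e)) _ _ ⟩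
  (forestCount j k (2 + e) + forestCount (3 + j) (2 + k) (suc e))
    + (forestCount (2 + j) (2 + k) (suc e) + forestCount (5 + j) (4 + k) e) ∎
  where open ≡-Reasoning

diag : ℕ → ℕ → ℕ
diag k n = forestCount k k n

-- With S the generating function of diag 1, this is
-- S^(k+1) = S^k + x (S^(k+2) + S^(k+3)).
diag-suc : ∀ k n → diag (suc k) (suc n) ≡ diag k (suc n) + (diag (2 + k) n + diag (3 + k) n)
diag-suc k n = begin
  forestCount k (suc k) (suc n) + forestCount (3 + k) (3 + k) n
    ≡⟨ cong (_+ forestCount (3 + k) (3 + k) n) (forestCount-sucʳ k k n) ⟩
  (diag k (suc n) + diag (2 + k) n) + diag (3 + k) n
    ≡⟨ assoc (diag k (suc n)) _ _ ⟩
  diag k (suc n) + (diag (2 + k) n + diag (3 + k) n) ∎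
  where
  open ≡-Reasoning
  assoc : ∀ a b c → (a + b) + c ≡ a + (b + c)
  assoc = solve-∀

conv : (ℕ → ℕ) → (ℕ → ℕ) → ℕ → ℕ
conv F G zero    = F 0 * G 0
conv F G (suc n) = F 0 * G (suc n) + conv (F ∘ suc) G n

conv-congˡ : ∀ {F F′} G → (∀ n → F n ≡ F′ n) → ∀ n → conv F G n ≡ conv F′ G n
conv-congˡ G eq zero    = cong (_* G 0) (eq 0)
conv-congˡ G eq (suc n) =
  cong₂ _+_ (cong (_* G (suc n)) (eq 0)) (conv-congˡ G (eq ∘ suc) n)

conv-distribʳ : ∀ F F′ G n → conv (λ i → F i + F′ i) G n ≡ conv F G n + conv F′ G n
conv-distribʳ F F′ G zero    = distrib (F 0) (F′ 0) (G 0)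
  where
  distrib : ∀ a b c → (a + b) * c ≡ a * c + b * c
  distrib = solve-∀
conv-distribʳ F F′ G (suc n)
  rewrite conv-distribʳ (F ∘ suc) (F′ ∘ suc) G n =
  distrib (F 0) (F′ 0) (G (suc n)) (conv (F ∘ suc) G n) (conv (F′ ∘ suc) G n)
  where
  distrib : ∀ a b c d e → (a + b) * c + (d + e) ≡ (a * c + d) + (b * c + e)
  distrib = solve-∀

-- Both sides satisfy the recurrence `diag-suc` in `j`, since convolution is linear in its first
-- factor. This is the rule S^j S^k = S^(j+k).
conv-diag : ∀ j k n → conv (diag j) (diag k) n ≡ diag (j + k) n
conv-diag zero    k zero    = +-identityʳ _
conv-diag (suc j) k zero
  rewrite forestCount-zero j (suc j) | forestCount-zero k k
        | forestCount-zero (j + k) (suc j + k) = refl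
conv-diag zero    k (suc n) = zeroˡ n
  where
  conv-zeroˡ : ∀ n → conv (λ i → diag 0 (suc i)) (diag k) n ≡ 0
  conv-zeroˡ zero    = refl
  conv-zeroˡ (suc n) = conv-0 n
    where
    conv-0 : ∀ n → conv (λ _ → 0) (diag k) n ≡ 0
    conv-0 zero    = refl
    conv-0 (suc n) = conv-0 n
  zeroˡ : ∀ n → diag k (suc n) + 0 + conv (λ i → diag 0 (suc i)) (diag k) n ≡ diag k (suc n)
  zeroˡ n rewrite conv-zeroˡ n = trans (+-identityʳ _) (+-identityʳ _)
conv-diag (suc j) k (suc n) = begin
  diag (suc j) 0 * diag k (suc n) + conv (diag (suc j) ∘ suc) (diag k) n
    ≡⟨ cong₂ _+_ (cong (_* diag k (suc n)) zero-eq)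
         (conv-congˡ (diag k) (diag-suc j) n) ⟩
  diag j 0 * diag k (suc n)
    + conv (λ i → diag j (suc i) + (diag (2 + j) i + diag (3 + j) i)) (diag k) n
    ≡⟨ cong (diag j 0 * diag k (suc n) +_)
         (trans (conv-distribʳ (diag j ∘ suc) _ (diag k) n)
           (cong (conv (diag j ∘ suc) (diag k) n +_)
             (conv-distribʳ (diag (2 + j)) (diag (3 + j)) (diag k) n))) ⟩
  diag j 0 * diag k (suc n) + (conv (diag j ∘ suc) (diag k) n
    + (conv (diag (2 + j)) (diag k) n + conv (diag (3 + j)) (diag k) n))
    ≡⟨ assoc (diag j 0 * diag k (suc n)) _ _ ⟩
  conv (diag j) (diag k) (suc n)
    + (conv (diag (2 + j)) (diag k) n + conv (diag (3 + j)) (diag k) n)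
    ≡⟨ cong₂ _+_ (conv-diag j k (suc n))
         (cong₂ _+_ (conv-diag (2 + j) k n) (conv-diag (3 + j) k n)) ⟩
  diag (j + k) (suc n) + (diag (2 + (j + k)) n + diag (3 + (j + k)) n)
    ≡⟨ diag-suc (j + k) n ⟨
  diag (suc (j + k)) (suc n) ∎
  where
  open ≡-Reasoning
  zero-eq : diag (suc j) 0 ≡ diag j 0
  zero-eq = trans (forestCount-zero j (suc j)) (sym (forestCount-zero j j))
  assoc : ∀ a b c → a + (b + c) ≡ (a + b) + c
  assoc = solve-∀

-- Lagrange inversion

-- coeff n N m is the coefficient of wᵐ in (1 + w)ᴺ (2 + w)ⁿ.
coeff : ℕ → ℕ → ℕ → ℕ
coeff zero    N m = N C m
coeff (suc n) N m = coeff n N m + coeff n (suc N) m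

coeff-pascal : ∀ n N m → coeff n (suc N) (suc m) ≡ coeff n N m + coeff n N (suc m)
coeff-pascal zero    N m = sym (nCk+nC[k+1]≡[n+1]C[k+1] N m)
coeff-pascal (suc n) N m =
  trans (cong₂ _+_ (coeff-pascal n N m) (coeff-pascal n (suc N) m))
    (exchange (coeff n N m) (coeff n N (suc m)) (coeff n (suc N) m) (coeff n (suc N) (suc m)))

coeff-zero : ∀ n N M → coeff n N 0 ≡ coeff n M 0
coeff-zero zero    N M = refl
coeff-zero (suc n) N M = cong₂ _+_ (coeff-zero n N M) (coeff-zero n (suc N) (suc M))

-- By definition a further factor 2 + w acts as 1 + (1 + w). Here it acts as 2 plus w, the form from
-- which the powers of 2 in the closed form arise.
coeff-sucˡ : ∀ n N m → coeff (suc n) N (suc m) ≡ 2 * coeff n N (suc m) + coeff n N m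
coeff-sucˡ n N m rewrite coeff-pascal n N m = regroup (coeff n N m) (coeff n N (suc m))
  where
  regroup : ∀ a b → b + (a + b) ≡ 2 * b + a
  regroup = solve-∀

absorb : ∀ N m → suc m * (suc N C suc m) ≡ suc N * (N C m)
absorb zero    zero    = refl
absorb zero    (suc m) = *-zeroʳ m
absorb (suc N) zero rewrite sym (nCk+nC[k+1]≡[n+1]C[k+1] (suc N) 0) =
  trans (cong suc (trans (+-identityʳ _) (trans (sym (+-identityʳ _)) (absorb N 0)))) refl
absorb (suc N) (suc m) = begin
  (2 + m) * (suc (suc N) C (2 + m))
    ≡⟨ cong ((2 + m) *_) (nCk+nC[k+1]≡[n+1]C[k+1] (suc N) (suc m)) ⟨
  (2 + m) * (suc N C suc m + suc N C (2 + m))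
    ≡⟨ expand m (suc N C suc m) (suc N C (2 + m)) ⟩
  suc N C suc m + (suc m * (suc N C suc m) + (2 + m) * (suc N C (2 + m)))
    ≡⟨ cong (suc N C suc m +_) (cong₂ _+_ (absorb N m) (absorb N (suc m))) ⟩
  suc N C suc m + (suc N * (N C m) + suc N * (N C suc m))
    ≡⟨ cong (suc N C suc m +_) (factor N (N C m) (N C suc m)) ⟩
  suc N C suc m + suc N * (N C m + N C suc m)
    ≡⟨ cong (λ z → suc N C suc m + suc N * z) (nCk+nC[k+1]≡[n+1]C[k+1] N m) ⟩
  (2 + N) * (suc N C suc m) ∎
  where
  open ≡-Reasoning
  expand : ∀ m a b → (2 + m) * (a + b) ≡ a + ((1 + m) * a + (2 + m) * b)
  expand = solve-∀
  factor : ∀ N a b → (1 + N) * a + (1 + N) * b ≡ (1 + N) * (a + b)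
  factor = solve-∀

-- The coefficient form of
-- ((1 + w)ᴺ⁺¹ (2 + w)ⁿ)′ = (N+1) (1 + w)ᴺ (2 + w)ⁿ + n (1 + w)ᴺ⁺¹ (2 + w)ⁿ⁻¹.
coeff-derivative : ∀ n N m →
  suc m * coeff n (suc N) (suc m) ≡ suc N * coeff n N m + n * coeff (pred n) (suc N) m
coeff-derivative zero    N m = trans (absorb N m) (sym (+-identityʳ _))
coeff-derivative (suc n) N m = begin
  suc m * (coeff n (suc N) (suc m) + coeff n (2 + N) (suc m))
    ≡⟨ *-distribˡ-+ (suc m) (coeff n (suc N) (suc m)) _ ⟩
  suc m * coeff n (suc N) (suc m) + suc m * coeff n (2 + N) (suc m)
    ≡⟨ cong₂ _+_ (coeff-derivative n N m) (coeff-derivative n (suc N) m) ⟩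
  (suc N * coeff n N m + n * coeff (pred n) (suc N) m)
    + ((2 + N) * coeff n (suc N) m + n * coeff (pred n) (2 + N) m)
    ≡⟨ regroup N (coeff n N m) (coeff n (suc N) m) _ _ ⟩
  suc N * coeff (suc n) N m
    + (coeff n (suc N) m + (n * coeff (pred n) (suc N) m + n * coeff (pred n) (2 + N) m))
    ≡⟨ cong (λ z → suc N * coeff (suc n) N m + (coeff n (suc N) m + z)) (merge n) ⟩
  suc N * coeff (suc n) N m + suc n * coeff n (suc N) m ∎
  where
  open ≡-Reasoning
  regroup : ∀ N a b c d →
    ((1 + N) * a + c) + ((2 + N) * b + d) ≡ (1 + N) * (a + b) + (b + (c + d))
  regroup = solve-∀
  -- For `n` zero the factor `n` hides the default value of `pred n`.
  merge : ∀ n → n * coeff (pred n) (suc N) m + n * coeff (pred n) (2 + N) m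
              ≡ n * coeff n (suc N) m
  merge zero    = refl
  merge (suc n) = sym (*-distribˡ-+ (suc n) (coeff n (suc N) m) (coeff n (2 + N) m))

private
  -- The induction step of `diag-lagrange` with all coefficients abstracted. The terms subtracted in
  -- the second and third instances are added to both sides, Pascal's rule is applied to the sums,
  -- and they are cancelled again.
  combine : ∀ a b d x y z x₂ y₂ x₃ y₃ w →
    a + (2 * x + y) ≡ z → b + (2 * x₂ + y₂) ≡ y → d + (2 * x₃ + y₃) ≡ w →
    y + w ≡ (x₂ + x₃) + x → w ≡ (y₂ + y₃) + y →
    (a + (b + d)) + (2 * (y + w) + w) ≡ (y + w) + z
  combine a b d x y z x₂ y₂ x₃ y₃ w e₁ e₂ e₃ p₁ p₂ =
    +-cancelʳ-≡ (2 * (x₂ + x₃) + (y₂ + y₃)) _ _ (begin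
    ((a + (b + d)) + (2 * (y + w) + w)) + (2 * (x₂ + x₃) + (y₂ + y₃))
      ≡⟨ left a b d x₂ y₂ x₃ y₃ (y + w) w ⟩
    a + ((b + (2 * x₂ + y₂)) + (d + (2 * x₃ + y₃))) + (2 * (y + w) + w)
      ≡⟨ cong₂ (λ u v → a + u + v) (cong₂ _+_ e₂ e₃) (cong₂ (λ v w → 2 * v + w) p₁ p₂) ⟩
    a + (y + w) + (2 * ((x₂ + x₃) + x) + ((y₂ + y₃) + y))
      ≡⟨ right a y w x (x₂ + x₃) (y₂ + y₃) ⟩
    ((y + w) + (a + (2 * x + y))) + (2 * (x₂ + x₃) + (y₂ + y₃))
      ≡⟨ cong (λ z → ((y + w) + z) + (2 * (x₂ + x₃) + (y₂ + y₃))) e₁ ⟩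
    ((y + w) + z) + (2 * (x₂ + x₃) + (y₂ + y₃)) ∎)
    where
    open ≡-Reasoning
    left : ∀ a b d x₂ y₂ x₃ y₃ v w →
      ((a + (b + d)) + (2 * v + w)) + (2 * (x₂ + x₃) + (y₂ + y₃))
        ≡ a + ((b + (2 * x₂ + y₂)) + (d + (2 * x₃ + y₃))) + (2 * v + w)
    left = solve-∀
    right : ∀ a y w x u q →
      a + (y + w) + (2 * (u + x) + (q + y)) ≡ ((y + w) + (a + (2 * x + y))) + (2 * u + q)
    right = solve-∀

-- Lagrange inversion for S = 1 + w, w = x φ(w), φ(w) = (1 + w)² (2 + w):
-- [xⁿ] Sᵏ = [wⁿ] (1 + w)ᵏ φⁿ - [wⁿ⁻¹] (1 + w)ᵏ φⁿ⁻¹ φ′, for n + 1 instead of n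
-- and with the subtracted term moved to the left.
diag-lagrange : ∀ n k M → M ≡ n + n + k →
  diag k (suc n) + (2 * coeff (suc n) (1 + M) n + coeff n (2 + M) n)
    ≡ coeff (suc n) (2 + M) (suc n)
-- As S^0 has no higher coefficients, the two subtracted terms have to make up the whole right side.
-- They do, by the derivative of (1 + w)^(2n+2) (2 + w)^(n+1), whose first exponent is twice the
-- second.
diag-lagrange n zero M M≡ = sym (*-cancelˡ-≡ _ _ (suc n) (begin
  suc n * coeff (suc n) (2 + M) (suc n)
    ≡⟨ coeff-derivative (suc n) (1 + M) n ⟩
  (2 + M) * coeff (suc n) (1 + M) n + suc n * coeff n (2 + M) n
    ≡⟨ cong (λ z → (2 + z) * coeff (suc n) (1 + M) n + suc n * coeff n (2 + M) n) M≡ ⟩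
  (2 + (n + n + 0)) * coeff (suc n) (1 + M) n + suc n * coeff n (2 + M) n
    ≡⟨ factor n (coeff (suc n) (1 + M) n) (coeff n (2 + M) n) ⟩
  suc n * (2 * coeff (suc n) (1 + M) n + coeff n (2 + M) n) ∎))
  where
  open ≡-Reasoning
  factor : ∀ n a b → (2 + (n + n + 0)) * a + (1 + n) * b ≡ (1 + n) * (2 * a + b)
  factor = solve-∀
diag-lagrange zero (suc k) _ refl =
  trans
    (combine₀ (diag k 1) (coeff 1 (1 + k) 0) (coeff 0 (2 + k) 0) (coeff 1 (2 + k) 1)
      (diag-suc k 0) (forestCount-zero (2 + k) (2 + k)) (forestCount-zero (3 + k) (3 + k))
      (coeff-zero 1 (2 + k) (1 + k)) (coeff-zero 0 (3 + k) (2 + k)) refl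
      (diag-lagrange zero k k refl))
    (sym (coeff-pascal 1 (2 + k) 0))
  where
  combine₀ : ∀ a x y z {s b d x₁ y₁} → s ≡ a + (b + d) → b ≡ 1 → d ≡ 1 → x₁ ≡ x → y₁ ≡ y →
    x ≡ 2 → a + (2 * x + y) ≡ z → s + (2 * x₁ + y₁) ≡ x₁ + z
  combine₀ a _ y _ refl refl refl refl refl refl refl = regroup a y
    where
    regroup : ∀ a y → (a + 2) + (4 + y) ≡ 2 + (a + (4 + y))
    regroup = solve-∀
diag-lagrange n@(suc m) (suc k) _ refl =
  subst (λ M₁ → diag (suc k) (suc n) + (2 * coeff (suc n) (1 + M₁) n + coeff n (2 + M₁) n)
                  ≡ coeff (suc n) (2 + M₁) (suc n))
    (sym (+-suc (n + n) k))
    (trans (cong (_+ (2 * coeff (suc n) (2 + M) n + coeff n (3 + M) n)) (diag-suc k n))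
      (trans
        (combine (diag k (suc n)) (diag (2 + k) n) (diag (3 + k) n)
          (coeff (suc n) (1 + M) n) (coeff n (2 + M) n) (coeff (suc n) (2 + M) (suc n))
          (coeff n (1 + M) m) (coeff m (2 + M) m) (coeff n (2 + M) m) (coeff m (3 + M) m)
          (coeff n (3 + M) n)
          (diag-lagrange n k M refl)
          (diag-lagrange m (2 + k) M shift)
          (diag-lagrange m (3 + k) (suc M) (trans (cong suc shift) (sym (+-suc (m + m) (2 + k)))))
          (coeff-pascal (suc n) (1 + M) m)
          (coeff-pascal n (2 + M) m))
        (sym (coeff-pascal (suc n) (2 + M) n))))
  where
  M : ℕ
  M = n + n + k
  -- Lowering `n` by one and raising `k` by two preserves 2n + k, so the instances of the induction
  -- hypothesis involve neighbouring coefficients.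
  shift : M ≡ m + m + (2 + k)
  shift = arith m k
    where
    arith : ∀ m k → (1 + m) + (1 + m) + k ≡ m + m + (2 + k)
    arith = solve-∀

-- Lagrange inversion in its usual form, (n+1) [x^(n+1)] S^k = [w^n] k (1 + w)^(k-1) φ^(n+1).
-- Multiplying `diag-lagrange` by n + 1 and differentiating its right side makes the subtracted
-- terms cancel.
diag-coeff : ∀ n k → suc n * diag k (suc n) ≡ k * coeff (suc n) (1 + (n + n + k)) n
diag-coeff n k = +-cancelʳ-≡ (suc n * (2 * X + Y)) _ _ (begin
  suc n * diag k (suc n) + suc n * (2 * X + Y)
    ≡⟨ *-distribˡ-+ (suc n) (diag k (suc n)) _ ⟨
  suc n * (diag k (suc n) + (2 * X + Y))
    ≡⟨ cong (suc n *_) (diag-lagrange n k (n + n + k) refl) ⟩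
  suc n * coeff (suc n) (2 + (n + n + k)) (suc n)
    ≡⟨ coeff-derivative (suc n) (1 + (n + n + k)) n ⟩
  (2 + (n + n + k)) * X + suc n * Y
    ≡⟨ regroup n k X Y ⟩
  k * X + suc n * (2 * X + Y) ∎)
  where
  open ≡-Reasoning
  X Y : ℕ
  X = coeff (suc n) (1 + (n + n + k)) n
  Y = coeff n (2 + (n + n + k)) n
  regroup : ∀ n k x y →
    (2 + (n + n + k)) * x + (1 + n) * y ≡ k * x + (1 + n) * (2 * x + y)
  regroup = solve-∀

sumBelow : ℕ → (ℕ → ℕ) → ℕ
sumBelow zero    f = 0
sumBelow (suc n) f = f 0 + sumBelow n (f ∘ suc)

sumBelow-cong : ∀ n {f g} → (∀ i → f i ≡ g i) → sumBelow n f ≡ sumBelow n g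
sumBelow-cong zero    eq = refl
sumBelow-cong (suc n) eq = cong₂ _+_ (eq 0) (sumBelow-cong n (eq ∘ suc))

sumBelow-+ : ∀ n f g → sumBelow n (λ i → f i + g i) ≡ sumBelow n f + sumBelow n g
sumBelow-+ zero    f g = refl
sumBelow-+ (suc n) f g rewrite sumBelow-+ n (f ∘ suc) (g ∘ suc) =
  exchange (f 0) (g 0) _ _

sumBelow-* : ∀ n c f → sumBelow n (λ i → c * f i) ≡ c * sumBelow n f
sumBelow-* zero    c f = sym (*-zeroʳ c)
sumBelow-* (suc n) c f rewrite sumBelow-* n c (f ∘ suc) =
  sym (*-distribˡ-+ c (f 0) _)

sumBelow-last : ∀ n f → sumBelow (suc n) f ≡ sumBelow n f + f n
sumBelow-last zero    f = +-identityʳ (f 0)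
sumBelow-last (suc n) f rewrite sumBelow-last n (f ∘ suc) = sym (+-assoc (f 0) _ _)

-- The index `i` counts the factors 2 + w that contribute their 2; the other n - i contribute w,
-- which leaves w^(i+d) for (1 + w)^N.
coeff-sum : ∀ n N d → coeff n N (n + d) ≡ sumBelow (suc n) (λ i → 2 ^ i * (n C i) * (N C (i + d)))
coeff-sum zero    N d = sym (trans (+-identityʳ _) (+-identityʳ _))
coeff-sum (suc n) N d = begin
  coeff (suc n) N (suc (n + d))
    ≡⟨ coeff-sucˡ n N (n + d) ⟩
  2 * coeff n N (suc (n + d)) + coeff n N (n + d)
    ≡⟨ cong₂ (λ a b → 2 * a + b) (trans (cong (coeff n N) (sym (+-suc n d))) (coeff-sum n N (suc d)))
         (coeff-sum n N d) ⟩
  2 * sumBelow (suc n) (term n (suc d)) + sumBelow (suc n) (term n d)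
    ≡⟨ cong₂ _+_ (sym (sumBelow-* (suc n) 2 (term n (suc d)))) (pad n d) ⟩
  sumBelow (suc n) (λ i → 2 * term n (suc d) i) + (term n d 0 + sumBelow (suc n) (term n d ∘ suc))
    ≡⟨ regroup (sumBelow (suc n) (λ i → 2 * term n (suc d) i)) (term n d 0) _ ⟩
  term n d 0 + (sumBelow (suc n) (λ i → 2 * term n (suc d) i) + sumBelow (suc n) (term n d ∘ suc))
    ≡⟨ cong (term n d 0 +_) (sym (sumBelow-+ (suc n) (λ i → 2 * term n (suc d) i) (term n d ∘ suc))) ⟩
  term n d 0 + sumBelow (suc n) (λ i → 2 * term n (suc d) i + term n d (suc i))
    ≡⟨ cong (term n d 0 +_) (sumBelow-cong (suc n) step) ⟩
  term (suc n) d 0 + sumBelow (suc n) (term (suc n) d ∘ suc) ∎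
  where
  open ≡-Reasoning
  term : ℕ → ℕ → ℕ → ℕ
  term n d i = 2 ^ i * (n C i) * (N C (i + d))
  pad : ∀ n d → sumBelow (suc n) (term n d) ≡ sumBelow (suc (suc n)) (term n d)
  pad n d rewrite sumBelow-last (suc n) (term n d) | k>n⇒nCk≡0 (n<1+n n)
                | *-zeroʳ (2 ^ suc n) = sym (+-identityʳ _)
  regroup : ∀ a b c → a + (b + c) ≡ b + (a + c)
  regroup = solve-∀
  step : ∀ i → 2 * term n (suc d) i + term n d (suc i) ≡ term (suc n) d (suc i)
  step i rewrite sym (nCk+nC[k+1]≡[n+1]C[k+1] n i) | +-suc i d =
    distrib (2 ^ i) (n C i) (n C suc i) (N C suc (i + d))
    where
    distrib : ∀ p a b c → 2 * (p * a * c) + 2 * p * b * c ≡ 2 * p * (a + b) * c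
    distrib = solve-∀

-- This is the expansion of `coeff-sum` with -1 in place of `d`. At least one factor has to
-- contribute its 2, hence the shift from `i` to `suc i`.
coeff-subdiagonal : ∀ n N →
  coeff (suc n) N n ≡ sumBelow (suc n) (λ i → 2 ^ suc i * (N C i) * (suc n C suc i))
coeff-subdiagonal zero    N = refl
coeff-subdiagonal (suc n) N = begin
  coeff (2 + n) N (suc n)
    ≡⟨ coeff-sucˡ (suc n) N n ⟩
  2 * coeff (suc n) N (suc n) + coeff (suc n) N n
    ≡⟨ cong₂ (λ a b → 2 * a + b)
         (trans (cong (coeff (suc n) N) (sym (+-identityʳ (suc n)))) (coeff-sum (suc n) N 0))
         (coeff-subdiagonal n N) ⟩
  2 * sumBelow (2 + n) diagonal + sumBelow (suc n) (term (suc n))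
    ≡⟨ cong₂ _+_ (sym (sumBelow-* (2 + n) 2 diagonal)) pad ⟩
  sumBelow (2 + n) (λ i → 2 * diagonal i) + sumBelow (2 + n) (term (suc n))
    ≡⟨ sumBelow-+ (2 + n) (λ i → 2 * diagonal i) (term (suc n)) ⟨
  sumBelow (2 + n) (λ i → 2 * diagonal i + term (suc n) i)
    ≡⟨ sumBelow-cong (2 + n) step ⟩
  sumBelow (2 + n) (term (2 + n)) ∎
  where
  open ≡-Reasoning
  term : ℕ → ℕ → ℕ
  term m i = 2 ^ suc i * (N C i) * (m C suc i)
  diagonal : ℕ → ℕ
  diagonal i = 2 ^ i * (suc n C i) * (N C (i + 0))
  pad : sumBelow (suc n) (term (suc n)) ≡ sumBelow (2 + n) (term (suc n))
  pad rewrite sumBelow-last (suc n) (term (suc n)) | k>n⇒nCk≡0 (n<1+n (suc n))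
            | *-zeroʳ (2 ^ (2 + n) * (N C suc n)) = sym (+-identityʳ _)
  step : ∀ i → 2 * diagonal i + term (suc n) i ≡ term (2 + n) i
  step i rewrite sym (nCk+nC[k+1]≡[n+1]C[k+1] (suc n) i) | +-identityʳ i =
    distrib (2 ^ i) (suc n C i) (suc n C suc i) (N C i)
    where
    distrib : ∀ p a b c → 2 * (p * a * c) + 2 * p * c * b ≡ 2 * p * c * (a + b)
    distrib = solve-∀

-- Rational power series with natural coefficients

-- Division by 1 normalises through a gcd that is stuck on a variable; the explicit reduced fraction
-- lets sums and products compute.
fromℕ≡mkℚ : ∀ n → fromℕ n ≡ mkℚ (pos n) 0 (Coprime.sym (Coprime.1-coprimeTo n))
fromℕ≡mkℚ n = ℚ.normalize-coprime (Coprime.sym (Coprime.1-coprimeTo n))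

fromℕ-+ : ∀ m n → fromℕ (m + n) ≡ fromℕ m ℚ.+ fromℕ n
fromℕ-+ m n rewrite fromℕ≡mkℚ m | fromℕ≡mkℚ n =
  sym (cong (ℚ._/ 1) (cong₂ ℤ._+_ (ℤ.*-identityʳ (pos m)) (ℤ.*-identityʳ (pos n))))

fromℕ-* : ∀ m n → fromℕ (m * n) ≡ fromℕ m ℚ.* fromℕ n
fromℕ-* m n rewrite fromℕ≡mkℚ m | fromℕ≡mkℚ n = cong (ℚ._/ 1) (ℤ.pos-* m n)

-- The reduced form of a / (d+1) is unknown, so the cross-multiplication takes place among
-- unnormalised fractions.
fromℕ-quotient : ∀ d a x y → suc d * x ≡ a * y →
  fromℕ x ≡ (pos a ℚ./ suc d) ℚ.* fromℕ y
fromℕ-quotient d a x y eq = ℚ.toℚᵘ-injective (begin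
  toℚᵘ (fromℕ x)
    ≈⟨ ℚ.toℚᵘ-fromℚᵘ (ℚᵘ.mkℚᵘ (pos x) 0) ⟩
  ℚᵘ.mkℚᵘ (pos x) 0
    ≈⟨ ℚᵘ.*≡* cross ⟩
  ℚᵘ.mkℚᵘ (pos a) d ℚᵘ.* ℚᵘ.mkℚᵘ (pos y) 0
    ≈⟨ ℚᵘ.*-cong (ℚ.toℚᵘ-fromℚᵘ (ℚᵘ.mkℚᵘ (pos a) d)) (ℚ.toℚᵘ-fromℚᵘ (ℚᵘ.mkℚᵘ (pos y) 0)) ⟨
  toℚᵘ (pos a ℚ./ suc d) ℚᵘ.* toℚᵘ (fromℕ y)
    ≈⟨ ℚ.toℚᵘ-homo-* (pos a ℚ./ suc d) (fromℕ y) ⟨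
  toℚᵘ ((pos a ℚ./ suc d) ℚ.* fromℕ y) ∎)
  where
  open ℚᵘ.≃-Reasoning
  swap : ∀ d x → x * (suc d * 1) ≡ suc d * x
  swap = solve-∀
  cross : pos x ℤ.* pos (suc d * 1) ≡ (pos a ℤ.* pos y) ℤ.* pos 1
  cross = trans (sym (ℤ.pos-* x (suc d * 1)))
    (trans (cong pos (trans (swap d x) eq))
      (trans (ℤ.pos-* a y) (sym (ℤ.*-identityʳ _))))

∑-fromℕ : ∀ N f g → (∀ i → f i ≡ fromℕ (g i)) → ∑[ N ] f ≡ fromℕ (sumBelow (suc N) g)
∑-fromℕ N f g eq =
  trans (cong (foldr ℚ._+_ 0ℚ) (map-applyUpTo id f (suc N))) (applied (suc N) f g eq)
  where
  applied : ∀ n f g → (∀ i → f i ≡ fromℕ (g i)) →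
    foldr ℚ._+_ 0ℚ (applyUpTo f n) ≡ fromℕ (sumBelow n g)
  applied zero    f g eq = refl
  applied (suc n) f g eq =
    trans (cong₂ ℚ._+_ (eq 0) (applied n (f ∘ suc) (g ∘ suc) (eq ∘ suc)))
      (sym (fromℕ-+ (g 0) (sumBelow n (g ∘ suc))))

conv≡sumBelow : ∀ F G n → conv F G n ≡ sumBelow (suc n) (λ k → F k * G (n ∸ k))
conv≡sumBelow F G zero    = sym (+-identityʳ _)
conv≡sumBelow F G (suc n) = cong (λ z → F 0 * G (suc n) + z) (conv≡sumBelow (F ∘ suc) G n)

⊗-fromℕ : ∀ {F G} F′ G′ → (∀ n → F n ≡ fromℕ (F′ n)) → (∀ n → G n ≡ fromℕ (G′ n)) →
  ∀ n → (F ⊗ G) n ≡ fromℕ (conv F′ G′ n)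
⊗-fromℕ F′ G′ F≡ G≡ n = trans
  (∑-fromℕ n _ (λ k → F′ k * G′ (n ∸ k))
    (λ k → trans (cong₂ ℚ._*_ (F≡ k) (G≡ (n ∸ k))) (sym (fromℕ-* (F′ k) (G′ (n ∸ k))))))
  (cong fromℕ (sym (conv≡sumBelow F′ G′ n)))

½-double : ∀ x y → ½ ℚ.* (x ℚ.+ (y ℚ.+ y)) ≡ ½ ℚ.* x ℚ.+ y
½-double x y = begin
  ½ ℚ.* (x ℚ.+ (y ℚ.+ y))            ≡⟨ ℚ.*-distribˡ-+ ½ x (y ℚ.+ y) ⟩
  ½ ℚ.* x ℚ.+ ½ ℚ.* (y ℚ.+ y)        ≡⟨ cong (½ ℚ.* x ℚ.+_) (ℚ.*-distribˡ-+ ½ y y) ⟩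
  ½ ℚ.* x ℚ.+ (½ ℚ.* y ℚ.+ ½ ℚ.* y)  ≡⟨ cong (½ ℚ.* x ℚ.+_) (ℚ.*-distribʳ-+ y ½ ½) ⟨
  ½ ℚ.* x ℚ.+ 1ℚ ℚ.* y               ≡⟨ cong (½ ℚ.* x ℚ.+_) (ℚ.*-identityˡ y) ⟩
  ½ ℚ.* x ℚ.+ y                      ∎
  where open ≡-Reasoning

dropConstant : (ℕ → ℕ) → ℕ → ℕ
dropConstant F zero    = 0
dropConstant F (suc n) = F (suc n)

shift : (ℕ → ℕ) → ℕ → ℕ
shift F zero    = 0
shift F (suc n) = F n

conv-shiftʳ : ∀ F G n → conv F (shift G) (suc n) ≡ conv F G n
conv-shiftʳ F G zero    = trans (cong (λ z → F 0 * G 0 + z) (*-comm (F 1) 0)) (+-identityʳ _)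
conv-shiftʳ F G (suc n) = cong (λ z → F 0 * G (suc n) + z) (conv-shiftʳ (F ∘ suc) G n)

-- S - 1 = (S - 1) T + 2 T for T = x S².
diag-relation : ∀ n →
  diag 1 (suc n) ≡ conv (dropConstant (diag 1)) (shift (diag 2)) (suc n) + (diag 2 n + diag 2 n)
diag-relation zero    = refl
diag-relation (suc n) = begin
  diag 1 (2 + n)
    ≡⟨ diag-suc 0 (suc n) ⟩
  diag 2 (suc n) + diag 3 (suc n)
    ≡⟨ cong (diag 2 (suc n) +_) (conv-diag 1 2 (suc n)) ⟨
  diag 2 (suc n) + conv (diag 1) (diag 2) (suc n)
    ≡⟨ regroup (diag 2 (suc n)) (conv (diag 1 ∘ suc) (diag 2) n) ⟩
  conv (diag 1 ∘ suc) (diag 2) n + (diag 2 (suc n) + diag 2 (suc n))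
    ≡⟨ cong (_+ (diag 2 (suc n) + diag 2 (suc n))) (conv-shiftʳ (diag 1 ∘ suc) (diag 2) n) ⟨
  conv (dropConstant (diag 1)) (shift (diag 2)) (2 + n) + (diag 2 (suc n) + diag 2 (suc n)) ∎
  where
  open ≡-Reasoning
  regroup : ∀ a b → a + (1 * a + b) ≡ b + (a + a)
  regroup = solve-∀

summand : ℕ → ℕ → ℕ
summand n i = 2 ^ i * ((2 * n ∸ 1) C i) * ((n ∸ 1) C (i + 1))

-- In the factor 4, one 2 is the exponent of S in T = x S² and the other is split off from the
-- powers 2^(i+1) of `coeff-subdiagonal`.
diag2-closed : ∀ m → suc m * diag 2 (suc m) ≡ 4 * sumBelow (suc m) (summand (2 + m))
diag2-closed m = begin
  suc m * diag 2 (suc m)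
    ≡⟨ diag-coeff m 2 ⟩
  2 * coeff (suc m) (1 + (m + m + 2)) m
    ≡⟨ cong (λ N → 2 * coeff (suc m) N m) (index m) ⟩
  2 * coeff (suc m) N m
    ≡⟨ cong (2 *_) (coeff-subdiagonal m N) ⟩
  2 * sumBelow (suc m) (λ i → 2 ^ suc i * (N C i) * (suc m C suc i))
    ≡⟨ cong (2 *_) (sumBelow-cong (suc m) λ i →
         trans (double (2 ^ i) (N C i) (suc m C suc i))
           (cong (λ j → 2 * (2 ^ i * (N C i) * (suc m C j))) (+-comm 1 i))) ⟩
  2 * sumBelow (suc m) (λ i → 2 * summand (2 + m) i)
    ≡⟨ cong (2 *_) (sumBelow-* (suc m) 2 (summand (2 + m))) ⟩
  2 * (2 * sumBelow (suc m) (summand (2 + m)))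
    ≡⟨ *-assoc 2 2 (sumBelow (suc m) (summand (2 + m))) ⟨
  4 * sumBelow (suc m) (summand (2 + m)) ∎
  where
  open ≡-Reasoning
  N : ℕ
  N = 2 * (2 + m) ∸ 1
  index : ∀ m → 1 + (m + m + 2) ≡ 1 + (m + (2 + (m + 0)))
  index = solve-∀
  double : ∀ p a b → 2 * p * a * b ≡ 2 * (p * a * b)
  double = solve-∀

-- Trees

-- Blocks and chains are the classes A and L, with O = A L and P = A O unfolded:
-- node a b l c m consists of (a , b l) in P and (c , m) in O.
mutual
  data Block : Set where
    leaf : Block
    node : Block → Block → Chain → Block → Chain → Block

  data Chain : Set where
    nil  : Chain
    cons : Block → Block → Chain → Chain → Chain

mutual
  weightᴮ : Block → ℕ
  weightᴮ leaf             = 0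
  weightᴮ (node a b l c m) = suc (weightᴮ a + weightᴮ b + weightᶜ l + weightᴮ c + weightᶜ m)

  weightᶜ : Chain → ℕ
  weightᶜ nil            = 0
  weightᶜ (cons a b l m) = suc (weightᴮ a + weightᴮ b + weightᶜ l + weightᶜ m)

Forest : ℕ → ℕ → Set
Forest j k = Vec Block j × Vec Chain k

weightsᴮ : ∀ {j} → Vec Block j → ℕ
weightsᴮ []       = 0
weightsᴮ (a ∷ as) = weightᴮ a + weightsᴮ as

weightsᶜ : ∀ {k} → Vec Chain k → ℕ
weightsᶜ []       = 0
weightsᶜ (l ∷ ls) = weightᶜ l + weightsᶜ ls

weight : ∀ {j k} → Forest j k → ℕ
weight (as , ls) = weightsᴮ as + weightsᶜ ls

addLeaf : ∀ {j k} → Forest j k → Forest (suc j) k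
addLeaf (as , ls) = leaf ∷ as , ls

addNode : ∀ {j k} → Forest (3 + j) (2 + k) → Forest (suc j) k
addNode (a ∷ b ∷ c ∷ as , l ∷ m ∷ ls) = node a b l c m ∷ as , ls

addNil : ∀ {k} → Forest 0 k → Forest 0 (suc k)
addNil (as , ls) = as , nil ∷ ls

addCons : ∀ {k} → Forest 2 (2 + k) → Forest 0 (suc k)
addCons (a ∷ b ∷ [] , l ∷ m ∷ ls) = [] , cons a b l m ∷ ls

forests : ∀ j k → ℕ → List (Forest j k)
forests zero    zero    zero    = [ [] , [] ]
forests zero    zero    (suc e) = []
forests zero    (suc k) zero    = map addNil (forests zero k zero)
forests zero    (suc k) (suc e) =
  map addNil (forests zero k (suc e)) ++ map addCons (forests 2 (2 + k) e)
forests (suc j) k       zero    = map addLeaf (forests j k zero)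
forests (suc j) k       (suc e) =
  map addLeaf (forests j k (suc e)) ++ map addNode (forests (3 + j) (2 + k) e)

length-forests : ∀ j k e → length (forests j k e) ≡ forestCount j k e
length-forests zero    zero    zero    = refl
length-forests zero    zero    (suc e) = refl
length-forests zero    (suc k) zero    = trans (length-map addNil (forests 0 k 0)) (length-forests 0 k 0)
length-forests zero    (suc k) (suc e) =
  trans (length-++ (map addNil (forests 0 k (suc e))))
    (cong₂ _+_ (trans (length-map addNil (forests 0 k (suc e))) (length-forests 0 k (suc e)))
      (trans (length-map addCons (forests 2 (2 + k) e)) (length-forests 2 (2 + k) e)))
length-forests (suc j) k       zero    = trans (length-map addLeaf (forests j k 0)) (length-forests j k 0)
length-forests (suc j) k       (suc e) =
  trans (length-++ (map addLeaf (forests j k (suc e))))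
    (cong₂ _+_ (trans (length-map addLeaf (forests j k (suc e))) (length-forests j k (suc e)))
      (trans (length-map addNode (forests (3 + j) (2 + k) e)) (length-forests (3 + j) (2 + k) e)))

addLeaf-injective : ∀ {j k} {f g : Forest j k} → addLeaf f ≡ addLeaf g → f ≡ g
addLeaf-injective refl = refl

addNode-injective : ∀ {j k} {f g : Forest (3 + j) (2 + k)} → addNode f ≡ addNode g → f ≡ g
addNode-injective {f = a ∷ b ∷ c ∷ as , l ∷ m ∷ ls} {g = a′ ∷ b′ ∷ c′ ∷ as′ , l′ ∷ m′ ∷ ls′} refl = refl

addNil-injective : ∀ {k} {f g : Forest 0 k} → addNil f ≡ addNil g → f ≡ g
addNil-injective refl = refl

addCons-injective : ∀ {k} {f g : Forest 2 (2 + k)} → addCons f ≡ addCons g → f ≡ g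
addCons-injective {f = a ∷ b ∷ [] , l ∷ m ∷ ls} {g = a′ ∷ b′ ∷ [] , l′ ∷ m′ ∷ ls′} refl = refl

addLeaf≢addNode : ∀ {j k} {f : Forest j k} {g : Forest (3 + j) (2 + k)} → addLeaf f ≢ addNode g
addLeaf≢addNode {g = a ∷ b ∷ c ∷ as , l ∷ m ∷ ls} ()

addNil≢addCons : ∀ {k} {f : Forest 0 k} {g : Forest 2 (2 + k)} → addNil f ≢ addCons g
addNil≢addCons {g = a ∷ b ∷ [] , l ∷ m ∷ ls} ()

forests-unique : ∀ j k e → Unique (forests j k e)
forests-unique zero    zero    zero    = [] ∷ []
forests-unique zero    zero    (suc e) = []
forests-unique zero    (suc k) zero    = Unique.map⁺ addNil-injective (forests-unique zero k zero)
forests-unique zero    (suc k) (suc e) =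
  Unique.++⁺ (Unique.map⁺ addNil-injective (forests-unique zero k (suc e)))
    (Unique.map⁺ addCons-injective (forests-unique 2 (2 + k) e))
    λ (p , q) → let _ , _ , eq = ∈-map⁻ addNil p ; _ , _ , eq′ = ∈-map⁻ addCons q
                in addNil≢addCons (trans (sym eq) eq′)
forests-unique (suc j) k       zero    = Unique.map⁺ addLeaf-injective (forests-unique j k zero)
forests-unique (suc j) k       (suc e) =
  Unique.++⁺ (Unique.map⁺ addLeaf-injective (forests-unique j k (suc e)))
    (Unique.map⁺ addNode-injective (forests-unique (3 + j) (2 + k) e))
    λ (p , q) → let _ , _ , eq = ∈-map⁻ addLeaf p ; _ , _ , eq′ = ∈-map⁻ addNode q
                in addLeaf≢addNode (trans (sym eq) eq′)

addCons-weight : ∀ {k} (f : Forest 2 (2 + k)) → weight (addCons f) ≡ suc (weight f)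
addCons-weight (a ∷ b ∷ [] , l ∷ m ∷ ls) =
  cong suc (regroup (weightᴮ a) (weightᴮ b) (weightᶜ l) (weightᶜ m) (weightsᶜ ls))
  where
  regroup : ∀ a b l m s → a + b + l + m + s ≡ a + (b + 0) + (l + (m + s))
  regroup = solve-∀

addNode-weight : ∀ {j k} (f : Forest (3 + j) (2 + k)) → weight (addNode f) ≡ suc (weight f)
addNode-weight (a ∷ b ∷ c ∷ as , l ∷ m ∷ ls) =
  cong suc (regroup (weightᴮ a) (weightᴮ b) (weightᴮ c) (weightᶜ l) (weightᶜ m) (weightsᴮ as) (weightsᶜ ls))
  where
  regroup : ∀ a b c l m s u →
    a + b + l + c + m + s + u ≡ a + (b + (c + s)) + (l + (m + u))
  regroup = solve-∀

forests-complete : ∀ {j k} e (f : Forest j k) → weight f ≡ e → f ∈ forests j k e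
forests-complete zero    ([] , []) eq = here refl
forests-complete (suc e) ([] , []) ()
forests-complete zero    ([] , nil ∷ ls) eq = ∈-map⁺ addNil (forests-complete 0 ([] , ls) eq)
forests-complete (suc e) ([] , nil ∷ ls) eq =
  ∈-++⁺ˡ (∈-map⁺ addNil (forests-complete (suc e) ([] , ls) eq))
forests-complete (suc e) ([] , cons a b l m ∷ ls) eq =
  ∈-++⁺ʳ _ (∈-map⁺ addCons (forests-complete e f (suc-injective (trans (sym (addCons-weight f)) eq))))
  where
  f : Forest 2 _
  f = a ∷ b ∷ [] , l ∷ m ∷ ls
forests-complete zero    (leaf ∷ as , ls) eq = ∈-map⁺ addLeaf (forests-complete 0 (as , ls) eq)
forests-complete (suc e) (leaf ∷ as , ls) eq =
  ∈-++⁺ˡ (∈-map⁺ addLeaf (forests-complete (suc e) (as , ls) eq))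
forests-complete (suc e) (node a b l c m ∷ as , ls) eq =
  ∈-++⁺ʳ _ (∈-map⁺ addNode (forests-complete e f (suc-injective (trans (sym (addNode-weight f)) eq))))
  where
  f : Forest (3 + _) _
  f = a ∷ b ∷ c ∷ as , l ∷ m ∷ ls

forests-weight : ∀ j k e → All (λ f → weight f ≡ e) (forests j k e)
forests-weight zero    zero    zero    = refl ∷ []
forests-weight zero    zero    (suc e) = []
forests-weight zero    (suc k) zero    = All.map⁺ (forests-weight zero k zero)
forests-weight zero    (suc k) (suc e) = All.++⁺
  (All.map⁺ (forests-weight zero k (suc e)))
  (All.map⁺ (All.map (λ {f} eq → trans (addCons-weight f) (cong suc eq)) (forests-weight 2 (2 + k) e)))
forests-weight (suc j) k       zero    = All.map⁺ (forests-weight j k zero)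
forests-weight (suc j) k       (suc e) = All.++⁺
  (All.map⁺ (forests-weight j k (suc e)))
  (All.map⁺ (All.map (λ {f} eq → trans (addNode-weight f) (cong suc eq)) (forests-weight (3 + j) (2 + k) e)))

-- Separable lists

data Dir : Set where
  up down : Dir

flip : Dir → Dir
flip up   = down
flip down = up

-- A relation instead of the equation `u ≡ flip t`, so that the pairs (s, flip s) and (flip s, s)
-- are treated alike and no double `flip` has to be rewritten.
data Opp : Dir → Dir → Set where
  up-down : Opp up down
  down-up : Opp down up

Opp-flipʳ : ∀ s → Opp s (flip s)
Opp-flipʳ up   = up-down
Opp-flipʳ down = down-up

Opp-sym : ∀ {s t} → Opp s t → Opp t s
Opp-sym up-down = down-up
Opp-sym down-up = up-down

Opp-flipˡ : ∀ s → Opp (flip s) s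
Opp-flipˡ s = Opp-sym (Opp-flipʳ s)

flip-involutive : ∀ s → flip (flip s) ≡ s
flip-involutive up   = refl
flip-involutive down = refl

flip-injective : ∀ {s t} → flip s ≡ flip t → s ≡ t
flip-injective {s} {t} eq =
  trans (sym (flip-involutive s)) (trans (cong flip eq) (flip-involutive t))

Opp-cases : ∀ {t u} → Opp t u → ∀ s → s ≡ t ⊎ s ≡ u
Opp-cases up-down up   = inj₁ refl
Opp-cases up-down down = inj₂ refl
Opp-cases down-up up   = inj₂ refl
Opp-cases down-up down = inj₁ refl

flip≢ : ∀ {s} → flip s ≢ s
flip≢ {up}   ()
flip≢ {down} ()

infix 4 _<[_]_ _≪[_]_

_<[_]_ : ℕ → Dir → ℕ → Set
x <[ up ]   y = x < y
x <[ down ] y = y < x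

<[]-trans : ∀ s {x y z} → x <[ s ] y → y <[ s ] z → x <[ s ] z
<[]-trans up   p q = <-trans p q
<[]-trans down p q = <-trans q p

<[]-asym : ∀ s {x y} → x <[ s ] y → ¬ y <[ s ] x
<[]-asym up   = <-asym
<[]-asym down = <-asym

<[]-opp : ∀ {s t} → Opp s t → ∀ {x y} → x <[ s ] y → y <[ t ] x
<[]-opp up-down p = p
<[]-opp down-up p = p

<[]-clash : ∀ {s t} → Opp s t → ∀ {x y} → x <[ s ] y → ¬ x <[ t ] y
<[]-clash {t = t} o p q = <[]-asym t q (<[]-opp o p)

<[]-total : ∀ s {x y} → x ≢ y → x <[ s ] y ⊎ y <[ s ] x
<[]-total s {x} {y} x≢y with <-cmp x y
<[]-total s    x≢y | tri≈ _ x≡y _ = ⊥-elim (x≢y x≡y)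
<[]-total up   x≢y | tri< x<y _ _ = inj₁ x<y
<[]-total up   x≢y | tri> _ _ y<x = inj₂ y<x
<[]-total down x≢y | tri< x<y _ _ = inj₂ x<y
<[]-total down x≢y | tri> _ _ y<x = inj₁ y<x

_≪[_]_ : List ℕ → Dir → List ℕ → Set
xs ≪[ s ] ys = ∀ {x y} → x ∈ xs → y ∈ ys → x <[ s ] y

-- Direction up gives the pattern 2413 and direction down the pattern 3142.
Separable : List ℕ → Set
Separable xs = ∀ s {a b c d} → a ∷ b ∷ c ∷ d ∷ [] ⊆ xs →
  c <[ s ] a → a <[ s ] d → d <[ s ] b → ⊥

Separable-⊆ : ∀ {xs ys} → xs ⊆ ys → Separable ys → Separable xs
Separable-⊆ xs⊆ys sep s p = sep s (⊆-trans p xs⊆ys)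

⊆-++⁻ : ∀ (xs : List ℕ) {ys ws} → ws ⊆ xs ++ ys →
  ∃₂ λ us vs → ws ≡ us ++ vs × us ⊆ xs × vs ⊆ ys
⊆-++⁻ []       p          = [] , _ , refl , [] , p
⊆-++⁻ (x ∷ xs) (.x ∷ʳ p) with ⊆-++⁻ xs p
... | us , vs , eq , q , r = us , vs , eq , x ∷ʳ q , r
⊆-++⁻ (x ∷ xs) (refl ∷ p) with ⊆-++⁻ xs p
... | us , vs , eq , q , r = x ∷ us , vs , cong (x ∷_) eq , refl ∷ q , r

straddle : ∀ {t xs ys} → xs ≪[ t ] ys → ∀ s {x y x′ y′} →
  x ∈ xs → y ∈ ys → y <[ s ] x → x′ ∈ xs → y′ ∈ ys → x′ <[ s ] y′ → ⊥
straddle {t} below s x∈ y∈ y<x x′∈ y′∈ x′<y′ with Opp-cases (Opp-flipʳ s) t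
... | inj₁ refl = <[]-asym s y<x (below x∈ y∈)
... | inj₂ refl = <[]-clash (Opp-flipʳ s) x′<y′ (below x′∈ y′∈)

-- The patterns 2413 and 3142 are neither direct nor skew sums: wherever the boundary cuts
-- `a b c d`, two of the three inequalities cross it in opposite senses, although all comparisons
-- across it go in direction `t`.
Separable-++ : ∀ {t xs ys} → Separable xs → Separable ys → xs ≪[ t ] ys → Separable (xs ++ ys)
Separable-++ {xs = xs} sepˡ sepʳ below s p c<a a<d d<b with ⊆-++⁻ xs p
... | [] , _ , refl , q , r = sepʳ s r c<a a<d d<b
... | a ∷ [] , b ∷ c ∷ d ∷ [] , refl , q , r =
  straddle below s (Sublist.lookup q (here refl)) (Sublist.lookup r (there (here refl))) c<a
    (Sublist.lookup q (here refl)) (Sublist.lookup r (there (there (here refl)))) a<d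
... | a ∷ b ∷ [] , c ∷ d ∷ [] , refl , q , r =
  straddle below s (Sublist.lookup q (here refl)) (Sublist.lookup r (here refl)) c<a
    (Sublist.lookup q (here refl)) (Sublist.lookup r (there (here refl))) a<d
... | a ∷ b ∷ c ∷ [] , d ∷ [] , refl , q , r =
  straddle below s (Sublist.lookup q (there (here refl))) (Sublist.lookup r (here refl)) d<b
    (Sublist.lookup q (here refl)) (Sublist.lookup r (here refl)) a<d
... | _ ∷ _ ∷ _ ∷ _ ∷ [] , [] , refl , q , r = sepˡ s q c<a a<d d<b

-- Existence and uniqueness of first cuts

record Split (s : Dir) (xs : List ℕ) : Set where
  constructor split
  field
    {y z}   : ℕ
    {ys zs} : List ℕ
    eq      : xs ≡ (y ∷ ys) ++ (z ∷ zs)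
    below   : (y ∷ ys) ≪[ s ] (z ∷ zs)

-- Without an inversion around `x`, the entries below `x` form a prefix. The second alternative
-- exposes the first entry above `x`, which keeps the right part of a new split nonempty.
separate : ∀ s x bs → (∀ {b} → b ∈ bs → x ≢ b) →
  (∀ {b b′} → b′ ∷ b ∷ [] ⊆ bs → x <[ s ] b′ → b <[ s ] x → ⊥) →
  (∀ {b} → b ∈ bs → b <[ s ] x) ⊎
  ∃ λ cs → ∃ λ d → ∃ λ ds → bs ≡ cs ++ d ∷ ds ×
    (∀ {c} → c ∈ cs → c <[ s ] x) × (∀ {e} → e ∈ d ∷ ds → x <[ s ] e)
separate s x []       x∉ noInv = inj₁ λ ()
separate s x (b ∷ bs) x∉ noInv with <[]-total s (x∉ (here refl))
... | inj₁ x<b = inj₂ ([] , b , bs , refl , (λ ()) , above)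
  where
  above : ∀ {e} → e ∈ b ∷ bs → x <[ s ] e
  above (here refl) = x<b
  above (there e∈) with <[]-total s (x∉ (there e∈))
  ... | inj₁ x<e = x<e
  ... | inj₂ e<x = ⊥-elim (noInv (refl ∷ from∈ e∈) x<b e<x)
... | inj₂ b<x with separate s x bs (λ p → x∉ (there p)) (λ p → noInv (b ∷ʳ p))
...   | inj₁ all = inj₁ λ { (here refl) → b<x ; (there p) → all p }
...   | inj₂ (cs , d , ds , refl , low , high) =
  inj₂ (b ∷ cs , d , ds , refl , (λ { (here refl) → b<x ; (there p) → low p }) , high)

-- If as ≪[ s ] bs and no entry of bs below x comes after one above x, the
-- entries of bs below x can be moved to the left part of the decomposition;
-- an inversion b′, b in bs around x would complete x and any a in as to the
-- forbidden pattern x a b′ b.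
extend-split : ∀ {s xs} x → Unique (x ∷ xs) → Separable (x ∷ xs) → Split s xs → ∃ λ t → Split t (x ∷ xs)
extend-split {s} x (x∉ ∷ _) sep (split {a} {b} {as} {bs} refl below)
  with separate s x (b ∷ bs) (λ p → All.lookup x∉ (∈-++⁺ʳ (a ∷ as) p)) noInversion
  where
  noInversion : ∀ {c c′} → c′ ∷ c ∷ [] ⊆ b ∷ bs → x <[ s ] c′ → c <[ s ] x → ⊥
  noInversion p x<c′ c<x = sep (flip s)
    (refl ∷ Sublist.++⁺ {as = [ a ]} (refl ∷ minimum as) p)
    (<[]-opp (Opp-flipʳ s) x<c′) (<[]-opp (Opp-flipʳ s) c<x)
    (<[]-opp (Opp-flipʳ s) (below (here refl) (Sublist.lookup p (there (here refl)))))
-- The right part lies below `x` and the left part below the right one, so `x` alone splits off in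
-- the opposite direction.
... | inj₁ all = flip s , split {y = x} {ys = []} refl above
  where
  above : [ x ] ≪[ flip s ] (a ∷ as) ++ (b ∷ bs)
  above (here refl) p with ∈-++⁻ (a ∷ as) p
  ... | inj₁ q = <[]-opp (Opp-flipʳ s) (<[]-trans s (below q (here refl)) (all (here refl)))
  ... | inj₂ q = <[]-opp (Opp-flipʳ s) (all q)
... | inj₂ (cs , d , ds , bs≡ , low , high) =
  s , split {y = x} {ys = (a ∷ as) ++ cs}
    (cong (x ∷_) (trans (cong ((a ∷ as) ++_) bs≡) (sym (++-assoc (a ∷ as) cs (d ∷ ds))))) separated
  where
  separated : (x ∷ (a ∷ as) ++ cs) ≪[ s ] (d ∷ ds)
  separated (here refl) q = high q
  separated (there p)   q with ∈-++⁻ (a ∷ as) p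
  ... | inj₁ p′ = below p′ (subst (_ ∈_) (sym bs≡) (∈-++⁺ʳ cs q))
  ... | inj₂ p′ = <[]-trans s (low p′) (high q)

decompose : ∀ x y xs → Unique (x ∷ y ∷ xs) → Separable (x ∷ y ∷ xs) →
  ∃ λ s → Split s (x ∷ y ∷ xs)
decompose x y []       ((x≢y ∷ []) ∷ _) sep with <[]-total up x≢y
... | inj₁ x<y = up   , split {ys = []} refl λ { (here refl) (here refl) → x<y }
... | inj₂ y<x = down , split {ys = []} refl λ { (here refl) (here refl) → y<x }
decompose x y (z ∷ xs) u@(_ ∷ u′) sep =
  extend-split x u sep (proj₂ (decompose y z xs u′ (Separable-⊆ (x ∷ʳ ⊆-refl) sep)))

-- For separable lists without repetitions, Prim s says in positive form that
-- the list does not split in the direction opposite to s.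
data Prim (s : Dir) : List ℕ → Set where
  single : ∀ {x} → Prim s [ x ]
  joined : ∀ {xs} → Split s xs → Prim s xs

-- For opposite `t` and `u`, the condition on `ys` says that no earlier cut in direction `t` exists.
record Cut (t u : Dir) (xs : List ℕ) : Set where
  constructor cut
  field
    {ys zs} : List ℕ
    {z}     : ℕ
    eq      : xs ≡ ys ++ (z ∷ zs)
    below   : ys ≪[ t ] (z ∷ zs)
    prim    : Prim u ys

Unique-++ˡ : ∀ (xs : List ℕ) {ys} → Unique (xs ++ ys) → Unique xs
Unique-++ˡ []       u        = []
Unique-++ˡ (x ∷ xs) (x∉ ∷ u) = All.++⁻ˡ xs x∉ ∷ Unique-++ˡ xs u

Unique-++ʳ : ∀ (xs : List ℕ) {ys} → Unique (xs ++ ys) → Unique ys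
Unique-++ʳ []       u        = u
Unique-++ʳ (x ∷ xs) (x∉ ∷ u) = Unique-++ʳ xs u

length-cutˡ : ∀ (ys : List ℕ) {z zs k} → length (ys ++ z ∷ zs) ≤ suc k → length ys ≤ k
length-cutˡ ys {z} {zs} len rewrite length-++ ys {z ∷ zs} | +-suc (length ys) (length zs) =
  ≤-trans (m≤m+n (length ys) (length zs)) (s≤s⁻¹ len)

module _ {t u : Dir} (t⊥u : Opp t u) where

  mutual
    firstCut : ∀ k x xs → length xs ≤ k → Unique (x ∷ xs) → Separable (x ∷ xs) →
      Prim u (x ∷ xs) ⊎ Cut t u (x ∷ xs)
    firstCut k       x []       len uniq sep = inj₁ single
    firstCut (suc k) x (y ∷ xs) (s≤s len) uniq sep with decompose x y xs uniq sep
    ... | s , d with Opp-cases t⊥u s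
    ...   | inj₁ refl = inj₂ (refineSplit k (s≤s (s≤s len)) uniq sep d)
    ...   | inj₂ refl = inj₁ (joined d)

    -- If the left part has a first cut, this also cuts the whole list, because the right part lies
    -- beyond the entire left part. The right part is nonempty, so the bound `k` is again large
    -- enough for the tail of the left part.
    refineSplit : ∀ k {xs} → length xs ≤ suc (suc k) → Unique xs → Separable xs → Split t xs → Cut t u xs
    refineSplit k len uniq sep (split {y} {z} {ys} {zs} refl below)
      with firstCut k y ys (length-cutˡ ys (s≤s⁻¹ len)) (Unique-++ˡ (y ∷ ys) uniq)
             (Separable-⊆ (Sublist.++⁺ʳ (z ∷ zs) ⊆-refl) sep)
    ... | inj₁ prim = cut refl below prim
    ... | inj₂ (cut {ys₁} {zs₁} {z₁} eq below₁ prim) =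
      cut (trans (cong (_++ z ∷ zs) eq) (++-assoc ys₁ (z₁ ∷ zs₁) (z ∷ zs))) below₂ prim
      where
      below₂ : ys₁ ≪[ t ] (z₁ ∷ zs₁) ++ (z ∷ zs)
      below₂ p q with ∈-++⁻ (z₁ ∷ zs₁) q
      ... | inj₁ q′ = below₁ p q′
      ... | inj₂ q′ = below (subst (_ ∈_) (sym eq) (∈-++⁺ˡ p)) q′

-- Levi's lemma.
++-compare : ∀ (xs : List ℕ) {ys} xs′ {ys′} → xs ++ ys ≡ xs′ ++ ys′ →
  (xs ≡ xs′ × ys ≡ ys′) ⊎
  (∃₂ λ w ws → xs′ ≡ xs ++ w ∷ ws × ys ≡ (w ∷ ws) ++ ys′) ⊎
  (∃₂ λ w ws → xs ≡ xs′ ++ w ∷ ws × ys′ ≡ (w ∷ ws) ++ ys)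
++-compare []       []        eq = inj₁ (refl , eq)
++-compare []       (w ∷ ws)  eq = inj₂ (inj₁ (w , ws , refl , eq))
++-compare (w ∷ ws) []        eq = inj₂ (inj₂ (w , ws , refl , sym eq))
++-compare (x ∷ xs) (x′ ∷ xs′) eq with ∷-injective eq
... | refl , eq′ with ++-compare xs xs′ eq′
...   | inj₁ (p , q)                      = inj₁ (cong (x ∷_) p , q)
...   | inj₂ (inj₁ (w , ws , p , q))      = inj₂ (inj₁ (w , ws , cong (x ∷_) p , q))
...   | inj₂ (inj₂ (w , ws , p , q))      = inj₂ (inj₂ (w , ws , cong (x ∷_) p , q))

-- The first entries agree, and one of the two right parts contains the other.
Split-clash : ∀ {t u xs} → Opp t u → Split t xs → ¬ Split u xs
Split-clash t⊥u (split {y} {z} {ys} {zs} refl below) (split {y′} {z′} {ys′} {zs′} eq below′)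
  with ∷-injective eq
... | refl , eq′ with ++-compare ys ys′ eq′
...   | inj₁ (_ , refl) = <[]-clash t⊥u (below (here refl) (here refl)) (below′ (here refl) (here refl))
...   | inj₂ (inj₁ (w , ws , _ , q)) = <[]-clash t⊥u
  (below (here refl) (subst (z′ ∈_) (sym q) (∈-++⁺ʳ (w ∷ ws) (here refl)))) (below′ (here refl) (here refl))
...   | inj₂ (inj₂ (w , ws , _ , q)) = <[]-clash t⊥u
  (below (here refl) (here refl)) (below′ (here refl) (subst (z ∈_) (sym q) (∈-++⁺ʳ (w ∷ ws) (here refl))))

Prim-clash : ∀ {t u ys w ws} → Opp t u → Prim u ys → ys ≪[ t ] (w ∷ ws) → ¬ Prim u (ys ++ w ∷ ws)
Prim-clash {ys = []} t⊥u (joined (split () _)) below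
Prim-clash {ys = y ∷ []}      t⊥u prim below (joined d) = Split-clash t⊥u (split refl below) d
Prim-clash {ys = y ∷ y′ ∷ ys} t⊥u prim below (joined d) = Split-clash t⊥u (split refl below) d

-- If one left part were a proper prefix of the other, the longer one would split in direction `t`
-- at the end of the shorter one, which `Prim u` excludes.
cut-unique : ∀ {t u ys ys′ zs zs′} → Opp t u → Prim u ys → Prim u ys′ →
  ys ≪[ t ] zs → ys′ ≪[ t ] zs′ → ys ++ zs ≡ ys′ ++ zs′ → ys ≡ ys′ × zs ≡ zs′
cut-unique {ys = ys} {ys′} t⊥u prim prim′ below below′ eq with ++-compare ys ys′ eq
... | inj₁ same = same
... | inj₂ (inj₁ (w , ws , refl , refl)) = ⊥-elim (Prim-clash t⊥u prim (λ p q → below p (∈-++⁺ˡ q)) prim′)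
... | inj₂ (inj₂ (w , ws , refl , refl)) = ⊥-elim (Prim-clash t⊥u prim′ (λ p q → below′ p (∈-++⁺ˡ q)) prim)

-- Alternating lists

Alternating : Dir → List ℕ → Set
Alternating s []           = ⊤
Alternating s (x ∷ [])     = ⊤
Alternating s (x ∷ y ∷ xs) = x <[ s ] y × Alternating (flip s) (y ∷ xs)

-- The direction in which an alternating list starts when it continues xs
-- and xs starts with s; so it is s if length xs is even and flip s if not.
after : Dir → List ℕ → Dir
after s []       = s
after s (x ∷ xs) = after (flip s) xs

after-++ : ∀ s xs ys → after s (xs ++ ys) ≡ after (after s xs) ys
after-++ s []       ys = refl
after-++ s (x ∷ xs) ys = after-++ (flip s) xs ys

Alternating-tail : ∀ s x xs → Alternating s (x ∷ xs) → Alternating (flip s) xs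
Alternating-tail s x []       alt = tt
Alternating-tail s x (y ∷ xs) alt = proj₂ alt

Alternating-++⁻ˡ : ∀ s xs {ys} → Alternating s (xs ++ ys) → Alternating s xs
Alternating-++⁻ˡ s []           alt       = tt
Alternating-++⁻ˡ s (x ∷ [])     alt       = tt
Alternating-++⁻ˡ s (x ∷ y ∷ xs) (p , alt) = p , Alternating-++⁻ˡ (flip s) (y ∷ xs) alt

Alternating-++⁻ʳ : ∀ s xs {ys} → Alternating s (xs ++ ys) → Alternating (after s xs) ys
Alternating-++⁻ʳ s []       alt = alt
Alternating-++⁻ʳ s (x ∷ xs) alt = Alternating-++⁻ʳ (flip s) xs (Alternating-tail s x (xs ++ _) alt)

-- The step across the boundary goes in direction `t`, so the following one goes in direction
-- `flip t`. Thus the direction of a cut decides the parity of its left part: odd if `t` is `s`,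
-- even otherwise.
Alternating-junction : ∀ s {t} y ys {z zs} → Alternating s ((y ∷ ys) ++ (z ∷ zs)) →
  (y ∷ ys) ≪[ t ] (z ∷ zs) → after s (y ∷ ys) ≡ flip t
Alternating-junction s {t} y [] (p , alt) below with Opp-cases (Opp-flipʳ s) t
... | inj₁ refl = refl
... | inj₂ refl = ⊥-elim (<[]-clash (Opp-flipʳ s) p (below (here refl) (here refl)))
Alternating-junction s y (y′ ∷ ys) (p , alt) below =
  Alternating-junction (flip s) y′ ys alt (λ q → below (there q))

Alternating-++⁺ : ∀ s t xs ys → Alternating s xs → Alternating (after s xs) ys →
  xs ≪[ t ] ys → after s xs ≡ flip t → Alternating s (xs ++ ys)
Alternating-++⁺ s t []           ys       altˡ altʳ below eq = altʳ
Alternating-++⁺ s t (x ∷ [])     []       altˡ altʳ below eq = tt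
Alternating-++⁺ s t (x ∷ [])     (y ∷ ys) altˡ altʳ below eq =
  subst (x <[_] y) (flip-injective (sym eq)) (below (here refl) (here refl)) , altʳ
Alternating-++⁺ s t (x ∷ y ∷ xs) ys       (p , altˡ) altʳ below eq =
  p , Alternating-++⁺ (flip s) t (y ∷ xs) ys altˡ altʳ (λ q → below (there q)) eq

Unique-length-≤ : ∀ {A : Set} {xs ys : List A} → Unique xs → (∀ {x} → x ∈ xs → x ∈ ys) → length xs ≤ length ys
Unique-length-≤ {xs = []}     u           sub = z≤n
Unique-length-≤ {xs = x ∷ xs} (x∉ ∷ u) sub with ∈-∃++ (sub (here refl))
... | us , vs , refl = ≤-trans (s≤s (Unique-length-≤ u sub′)) (≤-reflexive count)
  where
  count : suc (length (us ++ vs)) ≡ length (us ++ x ∷ vs)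
  count rewrite length-++ us {vs} | length-++ us {x ∷ vs} = sym (+-suc (length us) (length vs))
  sub′ : ∀ {y} → y ∈ xs → y ∈ us ++ vs
  sub′ y∈ with ∈-++⁻ us (sub (there y∈))
  ... | inj₁ p           = ∈-++⁺ˡ p
  ... | inj₂ (here refl) = ⊥-elim (All.lookup x∉ y∈ refl)
  ... | inj₂ (there p)   = ∈-++⁺ʳ us p

Unique-length : ∀ {A : Set} {xs ys : List A} → Unique xs → Unique ys →
  (∀ {x} → x ∈ xs → x ∈ ys) → (∀ {x} → x ∈ ys → x ∈ xs) → length xs ≡ length ys
Unique-length u v sub sup = ≤-antisym (Unique-length-≤ u sub) (Unique-length-≤ v sup)

-- Lists of the entries of an interval

record Interval (o n : ℕ) (xs : List ℕ) : Set where
  constructor interval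
  field
    unique   : Unique xs
    bounded  : ∀ {x} → x ∈ xs → o ≤ x × x < o + n
    complete : ∀ {x} → o ≤ x → x < o + n → x ∈ xs

open Interval

Interval-length : ∀ {o n xs} → Interval o n xs → length xs ≡ n
Interval-length {o} {n} {xs} i = trans
  (Unique-length (unique i) (Unique.applyUpTo⁺₁ (o +_) n λ i<j _ eq → <⇒≢ i<j (+-cancelˡ-≡ o _ _ eq)) sub sup)
  (length-applyUpTo (o +_) n)
  where
  sub : ∀ {x} → x ∈ xs → x ∈ applyUpTo (o +_) n
  sub {x} x∈ = subst (_∈ applyUpTo (o +_) n) (m+[n∸m]≡n o≤x)
    (∈-applyUpTo⁺ (o +_) (+-cancelˡ-< o (x ∸ o) n (subst (_< o + n) (sym (m+[n∸m]≡n o≤x)) (proj₂ (bounded i x∈)))))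
    where
    o≤x : o ≤ x
    o≤x = proj₁ (bounded i x∈)
  sup : ∀ {x} → x ∈ applyUpTo (o +_) n → x ∈ xs
  sup x∈ with ∈-applyUpTo⁻ (o +_) x∈
  ... | j , j<n , refl = complete i (m≤m+n o j) (+-monoʳ-< o j<n)

Interval-++ : ∀ {o m n xs ys} → Interval o m xs → Interval (o + m) n ys → Interval o (m + n) (xs ++ ys)
Interval-++ {o} {m} {n} {xs} {ys} i j = interval
  (Unique.++⁺ (unique i) (unique j) λ (p , q) → <⇒≱ (proj₂ (bounded i p)) (proj₁ (bounded j q)))
  bound compl
  where
  assoc : o + m + n ≡ o + (m + n)
  assoc = +-assoc o m n
  bound : ∀ {x} → x ∈ xs ++ ys → o ≤ x × x < o + (m + n)
  bound {x} p with ∈-++⁻ xs p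
  ... | inj₁ q = proj₁ (bounded i q) , <-≤-trans (proj₂ (bounded i q)) (subst (o + m ≤_) assoc (m≤m+n (o + m) n))
  ... | inj₂ q = ≤-trans (m≤m+n o m) (proj₁ (bounded j q)) , subst (x <_) assoc (proj₂ (bounded j q))
  compl : ∀ {x} → o ≤ x → x < o + (m + n) → x ∈ xs ++ ys
  compl {x} o≤x x< with x <? o + m
  ... | yes x<o+m = ∈-++⁺ˡ (complete i o≤x x<o+m)
  ... | no  x≮o+m = ∈-++⁺ʳ xs (complete j (≮⇒≥ x≮o+m) (subst (x <_) (sym assoc) x<))

Interval-swap : ∀ {o n} xs {ys} → Interval o n (xs ++ ys) → Interval o n (ys ++ xs)
Interval-swap {o} {n} xs {ys} i = interval
  (Unique.++⁺ (Unique-++ʳ xs (unique i)) (Unique-++ˡ xs (unique i)) (λ (p , q) → disjoint xs (unique i) q p))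
  (λ p → bounded i (swap ys p)) (λ p q → swap xs (complete i p q))
  where
  swap : ∀ us {vs} {x : ℕ} → x ∈ us ++ vs → x ∈ vs ++ us
  swap us {vs} p with ∈-++⁻ us p
  ... | inj₁ q = ∈-++⁺ʳ vs q
  ... | inj₂ q = ∈-++⁺ˡ q
  disjoint : ∀ us {vs} {x : ℕ} → Unique (us ++ vs) → x ∈ us → x ∈ vs → ⊥
  disjoint (u ∷ us) (u∉ ∷ _) (here refl) q = All.lookup u∉ (∈-++⁺ʳ us q) refl
  disjoint (u ∷ us) (_ ∷ uq) (there p)   q = disjoint us uq p q

strictBound : ℕ → List ℕ → ℕ
strictBound o []       = o
strictBound o (x ∷ xs) = suc x ⊔ strictBound o xs

strictBound-≥ : ∀ o xs → o ≤ strictBound o xs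
strictBound-≥ o []       = ≤-refl
strictBound-≥ o (x ∷ xs) = ≤-trans (strictBound-≥ o xs) (m≤n⊔m (suc x) _)

strictBound-> : ∀ o {x} xs → x ∈ xs → x < strictBound o xs
strictBound-> o (x ∷ xs) (here refl) = m≤m⊔n (suc x) (strictBound o xs)
strictBound-> o (x ∷ xs) (there p)   = ≤-trans (strictBound-> o xs p) (m≤n⊔m (suc x) _)

strictBound-least : ∀ o {b} xs → o ≤ b → (∀ {x} → x ∈ xs → x < b) → strictBound o xs ≤ b
strictBound-least o []       o≤b lt = o≤b
strictBound-least o (x ∷ xs) o≤b lt = ⊔-lub (lt (here refl)) (strictBound-least o xs o≤b (λ p → lt (there p)))

-- The least strict bound `p` of `xs` divides the values: those below it cannot occur in `ys`, the
-- others cannot occur in `xs`. The sizes are first read off from `p` and then identified with the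
-- lengths.
Interval-split : ∀ {o n} xs {ys} → Interval o n (xs ++ ys) → xs ≪[ up ] ys →
  Interval o (length xs) xs × Interval (o + length xs) (length ys) ys
Interval-split {o} {n} xs {ys} i below =
  subst (λ k → Interval o k xs) (sym lenˡ) left ,
  subst₂ (λ k l → Interval (o + k) l ys) (sym lenˡ) (sym lenʳ) right
  where
  p m k : ℕ
  p = strictBound o xs
  m = p ∸ o
  k = (o + n) ∸ p
  o+m : o + m ≡ p
  o+m = m+[n∸m]≡n (strictBound-≥ o xs)
  p+k : p + k ≡ o + n
  p+k = m+[n∸m]≡n (strictBound-least o xs (m≤m+n o n) (λ q → proj₂ (bounded i (∈-++⁺ˡ q))))
  p≤ys : ∀ {y} → y ∈ ys → p ≤ y
  p≤ys y∈ = strictBound-least o xs (proj₁ (bounded i (∈-++⁺ʳ xs y∈))) (λ q → below q y∈)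
  completeˡ : ∀ {x} → o ≤ x → x < o + m → x ∈ xs
  completeˡ {x} o≤x x< with ∈-++⁻ xs (complete i o≤x
      (<-≤-trans (subst (x <_) o+m x<) (subst (p ≤_) p+k (m≤m+n p k))))
  ... | inj₁ q = q
  ... | inj₂ q = ⊥-elim (<⇒≱ (subst (x <_) o+m x<) (p≤ys q))
  left : Interval o m xs
  left = interval (Unique-++ˡ xs (unique i))
    (λ q → proj₁ (bounded i (∈-++⁺ˡ q)) , subst (_ <_) (sym o+m) (strictBound-> o xs q))
    completeˡ
  completeʳ : ∀ {x} → o + m ≤ x → x < o + m + k → x ∈ ys
  completeʳ {x} o+m≤x x< with ∈-++⁻ xs (complete i (≤-trans (m≤m+n o m) o+m≤x)
      (subst (x <_) (trans (cong (_+ k) o+m) p+k) x<))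
  ... | inj₁ q = ⊥-elim (<⇒≱ (strictBound-> o xs q) (subst (_≤ x) o+m o+m≤x))
  ... | inj₂ q = q
  right : Interval (o + m) k ys
  right = interval (Unique-++ʳ xs (unique i))
    (λ {y} q → subst (_≤ y) (sym o+m) (p≤ys q) ,
           subst (y <_) (sym (trans (cong (_+ k) o+m) p+k)) (proj₂ (bounded i (∈-++⁺ʳ xs q))))
    completeʳ
  lenˡ : length xs ≡ m
  lenˡ = Interval-length left
  lenʳ : length ys ≡ k
  lenʳ = Interval-length right

-- Direct and skew sums of lists at arbitrary offsets

offsetˡ offsetʳ : Dir → ℕ → ℕ → ℕ
offsetˡ up   o n = o
offsetˡ down o n = o + n
offsetʳ up   o m = o + m
offsetʳ down o m = o

-- A permutation pattern that can be realised on any interval of `size` values. In a sum, the part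
-- with the smaller values starts at the given offset and the other part is moved up by its size.
record Layout : Set where
  field
    size  : ℕ
    place : ℕ → List ℕ
    valid : ∀ o → Interval o size (place o)

open Layout

Interval-glue : ∀ s {o m n xs ys} → Interval (offsetˡ s o n) m xs → Interval (offsetʳ s o m) n ys →
  Interval o (m + n) (xs ++ ys)
Interval-glue up   i j = Interval-++ i j
Interval-glue down {o} {m} {n} {xs} {ys} i j =
  subst (λ k → Interval o k (xs ++ ys)) (+-comm n m) (Interval-swap ys (Interval-++ j i))

Interval-unglue : ∀ s {o n} xs {ys} → Interval o n (xs ++ ys) → xs ≪[ s ] ys →
  Interval (offsetˡ s o (length ys)) (length xs) xs × Interval (offsetʳ s o (length xs)) (length ys) ys
Interval-unglue up   xs i below = Interval-split xs i below
Interval-unglue down xs {ys} i below with Interval-split ys (Interval-swap xs i) (λ p q → below q p)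
... | j , k = k , j

Interval-≪ : ∀ s {o m n xs ys} → Interval (offsetˡ s o n) m xs → Interval (offsetʳ s o m) n ys → xs ≪[ s ] ys
Interval-≪ up   i j p q = <-≤-trans (proj₂ (bounded i p)) (proj₁ (bounded j q))
Interval-≪ down i j p q = <-≤-trans (proj₂ (bounded j q)) (proj₁ (bounded i p))

empty : Layout
empty = record { size = 0 ; place = λ _ → []
  ; valid = λ o → interval [] (λ ()) (λ p q → ⊥-elim (<⇒≱ q (subst (_≤ _) (sym (+-identityʳ o)) p))) }

point : Layout
point = record { size = 1 ; place = λ o → [ o ] ; valid = λ o → interval ([] ∷ [])
  (λ { (here refl) → ≤-refl , m<m+n o (s≤s z≤n) })
  (λ {x} p q → here (≤-antisym (s≤s⁻¹ (subst (x <_) (+-comm o 1) q)) p)) }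

glue : Dir → Layout → Layout → Layout
glue s L M = record
  { size  = size L + size M
  ; place = λ o → place L (offsetˡ s o (size M)) ++ place M (offsetʳ s o (size L))
  ; valid = λ o → Interval-glue s (valid L (offsetˡ s o (size M))) (valid M (offsetʳ s o (size L)))
  }

glue-≪ : ∀ s L M o → place L (offsetˡ s o (size M)) ≪[ s ] place M (offsetʳ s o (size L))
glue-≪ s L M o = Interval-≪ s (valid L (offsetˡ s o (size M))) (valid M (offsetʳ s o (size L)))

-- A parser finds the two layouts at offsets given by lengths of lists, while `glue` uses sizes of
-- layouts; validity of the layouts identifies the two.
glue-place : ∀ s L M o {xs ys} →
  place L (offsetˡ s o (length ys)) ≡ xs → place M (offsetʳ s o (length xs)) ≡ ys →
  place (glue s L M) o ≡ xs ++ ys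
glue-place s L M o {xs} {ys} eqˡ eqʳ = cong₂ _++_
  (trans (cong (λ n → place L (offsetˡ s o n)) sizeʳ) eqˡ)
  (trans (cong (λ m → place M (offsetʳ s o m)) sizeˡ) eqʳ)
  where
  sizeˡ : size L ≡ length xs
  sizeˡ = trans (sym (Interval-length (valid L _))) (cong length eqˡ)
  sizeʳ : size M ≡ length ys
  sizeʳ = trans (sym (Interval-length (valid M _))) (cong length eqʳ)

-- From trees to alternating separable lists

-- blockLayout s a starts in direction s, has odd length and does not split
-- in direction s; pairLayout s a b l starts in direction s, has even length
-- and does not split in direction flip s.
mutual
  blockLayout : Dir → Block → Layout
  blockLayout s leaf             = point
  blockLayout s (node a b l c m) = glue (flip s) (pairLayout s a b l) (oddLayout s c m)

  pairLayout : Dir → Block → Block → Chain → Layout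
  pairLayout s a b l = glue s (blockLayout s a) (oddLayout (flip s) b l)

  oddLayout : Dir → Block → Chain → Layout
  oddLayout s a l = glue s (blockLayout s a) (chainLayout (flip s) l)

  chainLayout : Dir → Chain → Layout
  chainLayout s nil            = empty
  chainLayout s (cons a b l m) = glue (flip s) (pairLayout s a b l) (chainLayout s m)

record Good (s e : Dir) (xs : List ℕ) : Set where
  constructor good
  field
    separable   : Separable xs
    alternating : Alternating s xs
    ends        : after s xs ≡ e

open Good

Good-++ : ∀ {s t e f xs ys} → xs ≪[ t ] ys → e ≡ flip t → Good s e xs → Good e f ys → Good s f (xs ++ ys)
Good-++ {s} {t} {xs = xs} {ys} below e≡ (good sepˡ altˡ refl) (good sepʳ altʳ ends) = good
  (Separable-++ sepˡ sepʳ below) (Alternating-++⁺ s t xs ys altˡ altʳ below e≡) (trans (after-++ s xs ys) ends)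

Separable-point : ∀ x → Separable [ x ]
Separable-point x s (.x ∷ʳ ())
Separable-point x s (refl ∷ ())

mutual
  block-good : ∀ s a o → Good s (flip s) (place (blockLayout s a) o)
  block-good s leaf             o = good (Separable-point o) tt refl
  block-good s (node a b l c m) o = Good-++ (glue-≪ (flip s) (pairLayout s a b l) (oddLayout s c m) o)
    (sym (flip-involutive s)) (pair-good s a b l _) (odd-good s c m _)

  pair-good : ∀ s a b l o → Good s s (place (pairLayout s a b l) o)
  pair-good s a b l o = Good-++ (glue-≪ s (blockLayout s a) (oddLayout (flip s) b l) o) refl
    (block-good s a _)
    (subst (λ e → Good (flip s) e (place (oddLayout (flip s) b l) (offsetʳ s o (size (blockLayout s a)))))
      (flip-involutive s) (odd-good (flip s) b l _))

  odd-good : ∀ s a l o → Good s (flip s) (place (oddLayout s a l) o)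
  odd-good s a l o = Good-++ (glue-≪ s (blockLayout s a) (chainLayout (flip s) l) o) refl
    (block-good s a _) (chain-good (flip s) l _)

  chain-good : ∀ s l o → Good s s (place (chainLayout s l) o)
  chain-good s nil            o = good (λ _ ()) tt refl
  chain-good s (cons a b l m) o = Good-++ (glue-≪ (flip s) (pairLayout s a b l) (chainLayout s m) o)
    (sym (flip-involutive s)) (pair-good s a b l _) (chain-good s m _)

NonEmpty : List ℕ → Set
NonEmpty xs = ∃₂ λ y ys → xs ≡ y ∷ ys

NonEmpty-++ˡ : ∀ {xs ys} → NonEmpty xs → NonEmpty (xs ++ ys)
NonEmpty-++ˡ {ys = ys} (x , xs , refl) = x , xs ++ ys , refl

odd-nonEmpty : ∀ {s} xs → after s xs ≡ flip s → NonEmpty xs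
odd-nonEmpty []       eq = ⊥-elim (flip≢ (sym eq))
odd-nonEmpty (x ∷ xs) eq = x , xs , refl

Prim-++ : ∀ {s xs ys} → NonEmpty xs → NonEmpty ys → xs ≪[ s ] ys → Prim s (xs ++ ys)
Prim-++ (_ , _ , refl) (_ , _ , refl) below = joined (split refl below)

block-nonEmpty : ∀ s a o → NonEmpty (place (blockLayout s a) o)
block-nonEmpty s a o = odd-nonEmpty _ (ends (block-good s a o))

pair-nonEmpty : ∀ s a b l o → NonEmpty (place (pairLayout s a b l) o)
pair-nonEmpty s a b l o = NonEmpty-++ˡ (block-nonEmpty s a _)

odd-layout-nonEmpty : ∀ s a l o → NonEmpty (place (oddLayout s a l) o)
odd-layout-nonEmpty s a l o = NonEmpty-++ˡ (block-nonEmpty s a _)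

block-prim : ∀ s a o → Prim (flip s) (place (blockLayout s a) o)
block-prim s leaf             o = single
block-prim s (node a b l c m) o = Prim-++ (pair-nonEmpty s a b l _) (odd-layout-nonEmpty s c m _)
  (glue-≪ (flip s) (pairLayout s a b l) (oddLayout s c m) o)

pair-prim : ∀ s a b l o → Prim s (place (pairLayout s a b l) o)
pair-prim s a b l o = Prim-++ (block-nonEmpty s a _) (odd-layout-nonEmpty (flip s) b l _)
  (glue-≪ s (blockLayout s a) (oddLayout (flip s) b l) o)

point≢++ : ∀ {x : ℕ} {xs ys} → NonEmpty xs → NonEmpty ys → [ x ] ≢ xs ++ ys
point≢++ (_ , []    , refl) (_ , _ , refl) ()
point≢++ (_ , _ ∷ _ , refl) (_ , _ , refl) ()

[]≢++ : ∀ {xs ys : List ℕ} → NonEmpty xs → [] ≢ xs ++ ys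
[]≢++ (_ , _ , refl) ()

mutual
  -- The offsets may differ, since the offset of one part depends on the size of the other, and
  -- these sizes are not yet known to agree.
  block-injective : ∀ s a a′ o o′ → place (blockLayout s a) o ≡ place (blockLayout s a′) o′ → a ≡ a′
  block-injective s leaf leaf o o′ eq = refl
  block-injective s leaf (node a b l c m) o o′ eq =
    ⊥-elim (point≢++ (pair-nonEmpty s a b l _) (odd-layout-nonEmpty s c m _) eq)
  block-injective s (node a b l c m) leaf o o′ eq =
    ⊥-elim (point≢++ (pair-nonEmpty s a b l _) (odd-layout-nonEmpty s c m _) (sym eq))
  block-injective s (node a b l c m) (node a′ b′ l′ c′ m′) o o′ eq
    with cut-unique (Opp-flipˡ s) (pair-prim s a b l _) (pair-prim s a′ b′ l′ _)
           (glue-≪ (flip s) (pairLayout s a b l) (oddLayout s c m) o)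
           (glue-≪ (flip s) (pairLayout s a′ b′ l′) (oddLayout s c′ m′) o′) eq
  ... | eq₁ , eq₂ with pair-injective s a b l a′ b′ l′ _ _ eq₁ | odd-injective s c m c′ m′ _ _ eq₂
  ...   | refl , refl , refl | refl , refl = refl

  pair-injective : ∀ s a b l a′ b′ l′ o o′ →
    place (pairLayout s a b l) o ≡ place (pairLayout s a′ b′ l′) o′ → a ≡ a′ × b ≡ b′ × l ≡ l′
  pair-injective s a b l a′ b′ l′ o o′ eq
    with cut-unique (Opp-flipʳ s) (block-prim s a _) (block-prim s a′ _)
           (glue-≪ s (blockLayout s a) (oddLayout (flip s) b l) o)
           (glue-≪ s (blockLayout s a′) (oddLayout (flip s) b′ l′) o′) eq
  ... | eq₁ , eq₂ = block-injective s a a′ _ _ eq₁ , odd-injective (flip s) b l b′ l′ _ _ eq₂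

  odd-injective : ∀ s a l a′ l′ o o′ →
    place (oddLayout s a l) o ≡ place (oddLayout s a′ l′) o′ → a ≡ a′ × l ≡ l′
  odd-injective s a l a′ l′ o o′ eq
    with cut-unique (Opp-flipʳ s) (block-prim s a _) (block-prim s a′ _)
           (glue-≪ s (blockLayout s a) (chainLayout (flip s) l) o)
           (glue-≪ s (blockLayout s a′) (chainLayout (flip s) l′) o′) eq
  ... | eq₁ , eq₂ = block-injective s a a′ _ _ eq₁ , chain-injective (flip s) l l′ _ _ eq₂

  chain-injective : ∀ s l l′ o o′ → place (chainLayout s l) o ≡ place (chainLayout s l′) o′ → l ≡ l′
  chain-injective s nil nil o o′ eq = refl
  chain-injective s nil (cons a b l m) o o′ eq = ⊥-elim ([]≢++ (pair-nonEmpty s a b l _) eq)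
  chain-injective s (cons a b l m) nil o o′ eq = ⊥-elim ([]≢++ (pair-nonEmpty s a b l _) (sym eq))
  chain-injective s (cons a b l m) (cons a′ b′ l′ m′) o o′ eq
    with cut-unique (Opp-flipˡ s) (pair-prim s a b l _) (pair-prim s a′ b′ l′ _)
           (glue-≪ (flip s) (pairLayout s a b l) (chainLayout s m) o)
           (glue-≪ (flip s) (pairLayout s a′ b′ l′) (chainLayout s m′) o′) eq
  ... | eq₁ , eq₂ with pair-injective s a b l a′ b′ l′ _ _ eq₁ | chain-injective s m m′ _ _ eq₂
  ...   | refl , refl , refl | refl = refl

-- From alternating separable lists to trees

record Valid (s : Dir) (o : ℕ) (xs : List ℕ) : Set where
  constructor mkValid
  field
    isInterval    : Interval o (length xs) xs
    isSeparable   : Separable xs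
    isAlternating : Alternating s xs

open Valid

Valid-++⁻ : ∀ {s t o} xs {ys} → Valid s o (xs ++ ys) → xs ≪[ t ] ys →
  Valid s (offsetˡ t o (length ys)) xs × Valid (after s xs) (offsetʳ t o (length xs)) ys
Valid-++⁻ {s} {t} xs {ys} (mkValid i sep alt) below with Interval-unglue t xs i below
... | iˡ , iʳ =
  mkValid iˡ (Separable-⊆ (Sublist.++⁺ʳ ys ⊆-refl) sep) (Alternating-++⁻ˡ s xs alt) ,
  mkValid iʳ (Separable-⊆ (Sublist.++⁺ˡ xs ⊆-refl) sep) (Alternating-++⁻ʳ s xs alt)

cut-after : ∀ {s t u o ys z zs} → Valid s o (ys ++ z ∷ zs) → ys ≪[ t ] (z ∷ zs) → Prim u ys →
  after s ys ≡ flip t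
cut-after {ys = []}     v below (joined (split () _))
cut-after {s} {ys = y ∷ ys} v below prim = Alternating-junction s y ys (isAlternating v) below

length-cutʳ : ∀ {u} {ys : List ℕ} zs {k} → Prim u ys → length (ys ++ zs) ≤ suc k → length zs ≤ k
length-cutʳ {ys = []}     zs (joined (split () _)) len
length-cutʳ {ys = y ∷ ys} zs prim (s≤s len) rewrite length-++ ys {zs} =
  ≤-trans (m≤n+m (length zs) (length ys)) len

module _ {t u : Dir} (t⊥u : Opp t u) where

  cutOrWhole : ∀ {s o} x xs → Valid s o (x ∷ xs) → Prim u (x ∷ xs) ⊎ Cut t u (x ∷ xs)
  cutOrWhole x xs v = firstCut t⊥u (length xs) x xs ≤-refl (unique (isInterval v)) (isSeparable v)

  splitToCut : ∀ {s o xs} → Valid s o xs → Split t xs → Cut t u xs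
  splitToCut {xs = xs} v =
    refineSplit t⊥u (length xs) (m≤n+m (length xs) 2) (unique (isInterval v)) (isSeparable v)

  -- In contrast to `Cut`, the right part may be empty. This covers the last member of a sequence,
  -- where an uncuttable list is its own left part.
  record Parts (s : Dir) (o : ℕ) (xs : List ℕ) : Set where
    constructor parts
    field
      {ys zs} : List ℕ
      eq      : xs ≡ ys ++ zs
      prim    : Prim u ys
      left    : Valid s (offsetˡ t o (length zs)) ys
      right   : Valid (flip t) (offsetʳ t o (length ys)) zs
      turn    : after s ys ≡ flip t

  toParts : ∀ {s o xs} → Valid s o xs → Cut t u xs → Parts s o xs
  toParts {s} {o} v (cut {ys} {zs} {z} refl below prim) with cut-after v below prim | Valid-++⁻ ys v below
  ... | turn | vˡ , vʳ = parts refl prim vˡ (subst (λ e → Valid e (offsetʳ t o (length ys)) (z ∷ zs)) turn vʳ) turn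

  whole : ∀ {s o xs} → after s xs ≡ flip t → Valid s o xs → Prim u xs → Parts s o xs
  whole {s} {o} {xs} turn v prim with Valid-++⁻ {t = t} xs (subst (Valid s o) (sym (++-identityʳ xs)) v) (λ _ ())
  ... | vˡ , vʳ = parts (sym (++-identityʳ xs)) prim vˡ
    (subst (λ e → Valid e (offsetʳ t o (length xs)) []) turn vʳ) turn

  firstParts : ∀ {s o} x xs → after s (x ∷ xs) ≡ flip t → Valid s o (x ∷ xs) → Parts s o (x ∷ xs)
  firstParts x xs turn v with cutOrWhole x xs v
  ... | inj₁ prim = whole turn v prim
  ... | inj₂ c    = toParts v c

length-++ˡ : ∀ (ys : List ℕ) {zs k} → length (ys ++ zs) ≤ k → length ys ≤ k
length-++ˡ ys {zs} len rewrite length-++ ys {zs} = ≤-trans (m≤m+n (length ys) (length zs)) len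

length-++ʳ : ∀ (ys : List ℕ) {zs k} → length (ys ++ zs) ≤ k → length zs ≤ k
length-++ʳ ys {zs} len rewrite length-++ ys {zs} = ≤-trans (m≤n+m (length zs) (length ys)) len

length-NonEmptyʳ : ∀ (ys : List ℕ) {zs k} → NonEmpty zs → length (ys ++ zs) ≤ suc k → length ys ≤ k
length-NonEmptyʳ ys (_ , _ , refl) = length-cutˡ ys

after-++⁻ : ∀ {s e f} ys {zs} → after s ys ≡ e → after s (ys ++ zs) ≡ f → after e zs ≡ f
after-++⁻ {s} ys {zs} refl eq = trans (sym (after-++ s ys zs)) eq

mutual
  -- The number `k` is fuel: every cycle of calls passes through `parseBlock` or `parseChain`, which
  -- lower it. `parsePair` may accept one entry more, because both of its parts are shorter than the
  -- pair.
  parseBlock : ∀ k s {o xs} → length xs ≤ k → Valid s o xs → Prim (flip s) xs → after s xs ≡ flip s →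
    ∃ λ a → place (blockLayout s a) o ≡ xs
  -- An interval of size one contains its lower end, so the only entry is `o`.
  parseBlock k s {o} len v single odd with complete (isInterval v) ≤-refl (m<m+n o (s≤s z≤n))
  ... | here refl = leaf , refl
  parseBlock zero    s () v (joined (split refl _)) odd
  parseBlock (suc k) s {o} len v (joined d) odd with toParts (Opp-flipˡ s) v (splitToCut (Opp-flipˡ s) v d)
  ... | parts {ys} {zs} refl prim left right turn =
    let turn′              = trans turn (flip-involutive s)
        oddʳ               = after-++⁻ ys turn′ odd
        right′             = subst (λ e → Valid e (offsetʳ (flip s) o (length ys)) zs) (flip-involutive s) right
        a , b , l , eqˡ    = parsePair k s (length-++ˡ ys len) left prim turn′
        c , m , eqʳ        = parseOdd k s (length-cutʳ zs prim len) right′ oddʳ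
    in node a b l c m , glue-place (flip s) (pairLayout s a b l) (oddLayout s c m) o eqˡ eqʳ

  parsePair : ∀ k s {o xs} → length xs ≤ suc k → Valid s o xs → Prim s xs → after s xs ≡ s →
    ∃ λ a → ∃₂ λ b l → place (pairLayout s a b l) o ≡ xs
  parsePair k s len v single even = ⊥-elim (flip≢ even)
  parsePair k s {o} len v (joined d) even with toParts (Opp-flipʳ s) v (splitToCut (Opp-flipʳ s) v d)
  ... | parts {ys} {zs} refl prim left right turn =
    let oddʳ         = trans (after-++⁻ ys turn even) (sym (flip-involutive s))
        a , eqˡ      = parseBlock k s (length-NonEmptyʳ ys (odd-nonEmpty zs oddʳ) len) left prim turn
        b , l , eqʳ  = parseOdd k (flip s) (length-cutʳ zs prim len) right oddʳ
    in a , b , l , glue-place s (blockLayout s a) (oddLayout (flip s) b l) o eqˡ eqʳ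

  parseOdd : ∀ k s {o xs} → length xs ≤ k → Valid s o xs → after s xs ≡ flip s →
    ∃₂ λ a l → place (oddLayout s a l) o ≡ xs
  parseOdd k s {xs = []}         len v odd = ⊥-elim (flip≢ (sym odd))
  parseOdd k s {o} {xs = x ∷ xs} len v odd with firstParts (Opp-flipʳ s) x xs odd v
  ... | parts {ys} {zs} eq prim left right turn =
    let len′    = subst (λ ws → length ws ≤ k) eq len
        a , eqˡ = parseBlock k s (length-++ˡ ys len′) left prim turn
        l , eqʳ = parseChain k (flip s) (length-++ʳ ys len′) right
                    (after-++⁻ ys turn (trans (cong (after s) (sym eq)) odd))
    in a , l , trans (glue-place s (blockLayout s a) (chainLayout (flip s) l) o eqˡ eqʳ) (sym eq)

  parseChain : ∀ k s {o xs} → length xs ≤ k → Valid s o xs → after s xs ≡ s →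
    ∃ λ l → place (chainLayout s l) o ≡ xs
  parseChain k       s {xs = []}         len v even = nil , refl
  parseChain (suc k) s {o} {xs = x ∷ xs} len v even
    with firstParts (Opp-flipˡ s) x xs (trans even (sym (flip-involutive s))) v
  ... | parts {ys} {zs} eq prim left right turn =
    let len′            = subst (λ ws → length ws ≤ suc k) eq len
        turn′           = trans turn (flip-involutive s)
        right′          = subst (λ e → Valid e (offsetʳ (flip s) o (length ys)) zs) (flip-involutive s) right
        a , b , l , eqˡ = parsePair k s (length-++ˡ ys len′) left prim turn′
        m , eqʳ         = parseChain k s (length-cutʳ zs prim len′) right′
                            (after-++⁻ ys turn′ (trans (cong (after s) (sym eq)) even))
    in cons a b l m , trans (glue-place (flip s) (pairLayout s a b l) (chainLayout s m) o eqˡ eqʳ) (sym eq)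

mutual
  -- Each `node` or `cons` accounts for two entries and each block for one more; this is the
  -- substitution x = z² with A = z B.
  block-size : ∀ s a → size (blockLayout s a) ≡ suc (2 * weightᴮ a)
  block-size s leaf             = refl
  block-size s (node a b l c m)
    rewrite block-size s a | block-size (flip s) b | chain-size (flip (flip s)) l
          | block-size s c | chain-size (flip s) m =
    arith (weightᴮ a) (weightᴮ b) (weightᶜ l) (weightᴮ c) (weightᶜ m)
    where
    arith : ∀ a b l c m →
      suc (2 * a) + (suc (2 * b) + 2 * l) + (suc (2 * c) + 2 * m) ≡ suc (2 * suc (a + b + l + c + m))
    arith = solve-∀

  chain-size : ∀ s l → size (chainLayout s l) ≡ 2 * weightᶜ l
  chain-size s nil            = refl
  chain-size s (cons a b l m)
    rewrite block-size s a | block-size (flip s) b | chain-size (flip (flip s)) l | chain-size s m =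
    arith (weightᴮ a) (weightᴮ b) (weightᶜ l) (weightᶜ m)
    where
    arith : ∀ a b l m → suc (2 * a) + (suc (2 * b) + 2 * l) + 2 * m ≡ 2 * suc (a + b + l + m)
    arith = solve-∀

-- Words as lists of natural numbers

entries : ∀ {m} → Word m m → List ℕ
entries w = tabulate (toℕ ∘ lookup w)

tabulate-injective : ∀ {m} {f g : Fin m → ℕ} → tabulate f ≡ tabulate g → ∀ i → f i ≡ g i
tabulate-injective eq zero    = proj₁ (∷-injective eq)
tabulate-injective eq (suc i) = tabulate-injective (proj₂ (∷-injective eq)) i

entries-injective : ∀ {m} {w w′ : Word m m} → entries w ≡ entries w′ → w ≡ w′
entries-injective {w = w} {w′} eq = trans (sym (tabulate∘lookup w))
  (trans (tabulate-cong (λ i → toℕ-injective (tabulate-injective eq i))) (tabulate∘lookup w′))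

entries-surjective : ∀ {m xs} → Interval 0 m xs → ∃ λ (w : Word m m) → entries w ≡ xs
entries-surjective {xs = xs} i with Interval-length i
... | refl = Vec.tabulate value , trans
  (tabulateᴸ-cong λ j → trans (cong toℕ (lookup∘tabulate value j)) (toℕ-fromℕ< _)) (tabulate-lookup xs)
  where
  value : Fin (length xs) → Fin (length xs)
  value j = fromℕ< (proj₂ (Interval.bounded i (∈-lookup j)))

Unique-tabulate⁻ : ∀ {m} (f : Fin m → ℕ) → Unique (tabulate f) → ∀ {i j} → f i ≡ f j → i ≡ j
Unique-tabulate⁻ f u        {zero}  {zero}  eq = refl
Unique-tabulate⁻ f (f₀∉ ∷ u) {zero}  {suc j} eq = ⊥-elim (All.lookup f₀∉ (∈-tabulate⁺ j) eq)
Unique-tabulate⁻ f (f₀∉ ∷ u) {suc i} {zero}  eq = ⊥-elim (All.lookup f₀∉ (∈-tabulate⁺ i) (sym eq))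
Unique-tabulate⁻ f (_ ∷ u)  {suc i} {suc j} eq = cong suc (Unique-tabulate⁻ (f ∘ suc) u eq)

permutation⇒interval : ∀ {m} (w : Word m m) → IsPermutation w → Interval 0 m (entries w)
permutation⇒interval {m} w (inj , surj) = interval
  (Unique.tabulate⁺ (inj ∘ toℕ-injective))
  (λ p → let i , eq = ∈-tabulate⁻ p in z≤n , subst (_< m) (sym eq) (toℕ<n (lookup w i)))
  (λ _ x<m → let i , eq = surj (fromℕ< x<m) in
    subst (_∈ entries w) (trans (cong toℕ (eq refl)) (toℕ-fromℕ< x<m)) (∈-tabulate⁺ i))

interval⇒permutation : ∀ {m} (w : Word m m) → Interval 0 m (entries w) → IsPermutation w
interval⇒permutation w i =
  (λ eq → Unique-tabulate⁻ (toℕ ∘ lookup w) (Interval.unique i) (cong toℕ eq)) ,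
  (λ y → let j , eq = ∈-tabulate⁻ (Interval.complete i z≤n (toℕ<n y)) in
    j , λ { refl → toℕ-injective (sym eq) })

turn : Dir → ℕ → Dir
turn s zero    = s
turn s (suc i) = turn (flip s) i

alternating⇒steps : ∀ {m} s (g : Fin m → ℕ) → Alternating s (tabulate g) →
  ∀ i j → toℕ j ≡ suc (toℕ i) → g i <[ turn s (toℕ i) ] g j
alternating⇒steps {suc (suc m)} s g (p , alt) zero    (suc zero) eq = p
alternating⇒steps {suc (suc m)} s g (p , alt) (suc i) (suc j)    eq =
  alternating⇒steps (flip s) (g ∘ suc) alt i j (suc-injective eq)

steps⇒alternating : ∀ {m} s (g : Fin m → ℕ) →
  (∀ i j → toℕ j ≡ suc (toℕ i) → g i <[ turn s (toℕ i) ] g j) → Alternating s (tabulate g)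
steps⇒alternating {zero}        s g steps = tt
steps⇒alternating {suc zero}    s g steps = tt
steps⇒alternating {suc (suc m)} s g steps =
  steps zero (suc zero) refl ,
  steps⇒alternating (flip s) (g ∘ suc) (λ i j eq → steps (suc i) (suc j) (cong suc eq))

turn-parity : ∀ i → (i % 2 ≡ 0 × turn up i ≡ up) ⊎ (i % 2 ≡ 1 × turn up i ≡ down)
turn-parity zero          = inj₁ (refl , refl)
turn-parity (suc zero)    = inj₂ (refl , refl)
turn-parity (suc (suc i)) = turn-parity i

upDown⇒alternating : ∀ {m} (w : Word m m) → IsUpDown w → Alternating up (entries w)
upDown⇒alternating w ud = steps⇒alternating up (toℕ ∘ lookup w) step
  where
  step : ∀ i j → toℕ j ≡ suc (toℕ i) → toℕ (lookup w i) <[ turn up (toℕ i) ] toℕ (lookup w j)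
  step i j eq with turn-parity (toℕ i)
  ... | inj₁ (even , turn≡) rewrite turn≡ = proj₁ (ud i j eq) even
  ... | inj₂ (odd  , turn≡) rewrite turn≡ = proj₂ (ud i j eq) odd

alternating⇒upDown : ∀ {m} (w : Word m m) → Alternating up (entries w) → IsUpDown w
alternating⇒upDown w alt i j eq with turn-parity (toℕ i) | alternating⇒steps up (toℕ ∘ lookup w) alt i j eq
... | inj₁ (even , turn≡) | p rewrite turn≡ = (λ _ → p) , (λ odd → contradiction (trans (sym even) odd) λ ())
... | inj₂ (odd , turn≡)  | p rewrite turn≡ = (λ even → contradiction (trans (sym even) odd) λ ()) , (λ _ → p)

-- Pattern occurrences as subsequences

increasing-suc⁺ : ∀ {m k} (p : Word m k) → IncreasingPositions p → IncreasingPositions (Vec.map Fin.suc p)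
increasing-suc⁺ p inc a b a<b rewrite lookup-map a Fin.suc p | lookup-map b Fin.suc p = s≤s (inc a b a<b)

increasing-suc⁻ : ∀ {m k} (p : Word m k) → IncreasingPositions (Vec.map Fin.suc p) → IncreasingPositions p
increasing-suc⁻ p inc a b a<b with inc a b a<b
... | q rewrite lookup-map a Fin.suc p | lookup-map b Fin.suc p = s≤s⁻¹ q

sublist⇒positions : ∀ {m} (g : Fin m → ℕ) {ws} → ws ⊆ tabulate g →
  ∃ λ (p : Word m (length ws)) → IncreasingPositions p × ∀ i → g (lookup p i) ≡ List.lookup ws i
sublist⇒positions {zero}  g []       = [] , (λ ()) , (λ ())
sublist⇒positions {suc m} g (_ ∷ʳ q) with sublist⇒positions (g ∘ suc) q
... | p , inc , eq = Vec.map Fin.suc p , increasing-suc⁺ p inc , λ i → trans (cong g (lookup-map i Fin.suc p)) (eq i)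
sublist⇒positions {suc m} g {_ ∷ ws} (refl ∷ q) with sublist⇒positions (g ∘ suc) q
... | p , inc , eq = zero ∷ Vec.map Fin.suc p , increasing , values
  where
  increasing : IncreasingPositions (zero ∷ Vec.map Fin.suc p)
  increasing zero    (suc b) _   rewrite lookup-map b Fin.suc p = s≤s z≤n
  increasing (suc a) (suc b) a<b = increasing-suc⁺ p inc a b (s≤s⁻¹ a<b)
  values : ∀ i → g (lookup (zero ∷ Vec.map Fin.suc p) i) ≡ List.lookup (g zero ∷ ws) i
  values zero    = refl
  values (suc i) = trans (cong g (lookup-map i Fin.suc p)) (eq i)

positive⇒suc : ∀ {m k} (p : Word (suc m) k) → (∀ a → 0 < toℕ (lookup p a)) →
  ∃ λ (q : Word m k) → p ≡ Vec.map Fin.suc q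
positive⇒suc []           0<p = [] , refl
positive⇒suc (zero ∷ p)   0<p = ⊥-elim (<-irrefl refl (0<p zero))
positive⇒suc (suc x ∷ p)  0<p with positive⇒suc p (0<p ∘ suc)
... | q , refl = x ∷ q , refl

-- A first position zero takes the head of the list, any other skips it. In both cases the later
-- positions are positive and hence lie in the tail.
positions⇒sublist : ∀ {m k} (g : Fin m → ℕ) (p : Word m k) → IncreasingPositions p →
  toList (Vec.map g p) ⊆ tabulate g
positions⇒sublist g [] inc = minimum _
positions⇒sublist {suc m} g (zero ∷ p) inc with positive⇒suc p (λ a → inc zero (suc a) (s≤s z≤n))
... | q , refl rewrite sym (map-∘ g Fin.suc q) =
  refl ∷ positions⇒sublist (g ∘ suc) q (increasing-suc⁻ q λ a b a<b → inc (suc a) (suc b) (s≤s a<b))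
positions⇒sublist {suc m} g (suc x ∷ p) inc
  with positive⇒suc p (λ a → <-trans (s≤s z≤n) (inc zero (suc a) (s≤s z≤n)))
... | q , refl rewrite sym (map-∘ g Fin.suc q) =
  _ ∷ʳ positions⇒sublist (g ∘ suc) (x ∷ q) (increasing-suc⁻ (x ∷ q) inc)

Sorted : ∀ {k} → Vec ℕ k → Set
Sorted []           = ⊤
Sorted (x ∷ [])     = ⊤
Sorted (x ∷ y ∷ xs) = x < y × Sorted (y ∷ xs)

Sorted-mono : ∀ {k} (xs : Vec ℕ k) → Sorted xs → ∀ i j → i Fin.< j → lookup xs i < lookup xs j
Sorted-mono (x ∷ y ∷ xs) (x<y , s) zero    (suc zero)    i<j = x<y
Sorted-mono (x ∷ y ∷ xs) (x<y , s) zero    (suc (suc j)) i<j =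
  <-trans x<y (Sorted-mono (y ∷ xs) s zero (suc j) (s≤s z≤n))
Sorted-mono (x ∷ y ∷ xs) (x<y , s) (suc i) (suc j)       i<j = Sorted-mono (y ∷ xs) s i j (s≤s⁻¹ i<j)

Sorted-⇔ : ∀ {k} (xs : Vec ℕ k) → Sorted xs → ∀ i j → i Fin.< j ⇔ lookup xs i < lookup xs j
Sorted-⇔ xs s i j = mk⇔ (Sorted-mono xs s i j) reflect
  where
  reflect : lookup xs i < lookup xs j → i Fin.< j
  reflect lt with Fin.<-cmp i j
  ... | tri< i<j _ _ = i<j
  ... | tri≈ _ refl _ = ⊥-elim (<-irrefl refl lt)
  ... | tri> _ _ j<i = ⊥-elim (<-asym lt (Sorted-mono xs s j i j<i))

-- An occurrence of σ is a subsequence whose i-th entry is the σ(i)-th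
-- smallest of its entries.
occurrence : ∀ {m} (w : Word m m) ws (σ : Word (length ws) (length ws)) (sorted : Vec ℕ (length ws)) →
  Sorted sorted → (∀ i → List.lookup ws i ≡ lookup sorted (lookup σ i)) → ws ⊆ entries w → Contains w σ
occurrence w ws σ sorted isSorted eq ws⊆ with sublist⇒positions (toℕ ∘ lookup w) ws⊆
... | p , inc , values = p , inc , λ a b →
  subst₂ (λ x y → lookup σ a Fin.< lookup σ b ⇔ x < y)
    (sym (trans (values a) (eq a))) (sym (trans (values b) (eq b)))
    (Sorted-⇔ sorted isSorted (lookup σ a) (lookup σ b))

-- The three inequalities already order all four entries, as the given vectors record. Reversing
-- them exchanges the patterns 2413 and 3142.
avoids⇒separable : ∀ {m} (w : Word m m) → Avoids w p2413 → Avoids w p3142 → Separable (entries w)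
avoids⇒separable w avoid₁ avoid₂ up {a} {b} {c} {d} sub c<a a<d d<b =
  avoid₁ (occurrence w (a ∷ b ∷ c ∷ d ∷ []) p2413 (c ∷ a ∷ d ∷ b ∷ []) (c<a , a<d , d<b , tt)
    (λ { zero → refl ; (suc zero) → refl ; (suc (suc zero)) → refl ; (suc (suc (suc zero))) → refl }) sub)
avoids⇒separable w avoid₁ avoid₂ down {a} {b} {c} {d} sub a<c d<a b<d =
  avoid₂ (occurrence w (a ∷ b ∷ c ∷ d ∷ []) p3142 (b ∷ d ∷ a ∷ c ∷ []) (b<d , d<a , a<c , tt)
    (λ { zero → refl ; (suc zero) → refl ; (suc (suc zero)) → refl ; (suc (suc (suc zero))) → refl }) sub)

-- The 0-based positions 2, 0, 3, 1 list the pattern in increasing order; neighbours in this order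
-- yield the three inequalities.
separable⇒avoids-2413 : ∀ {m} (w : Word m m) → Separable (entries w) → Avoids w p2413
separable⇒avoids-2413 w sep (p@(_ ∷ _ ∷ _ ∷ _ ∷ []) , inc , iso) =
  sep up (positions⇒sublist (toℕ ∘ lookup w) p inc)
    (Equivalence.to (iso (# 2) (# 0)) (s≤s z≤n))
    (Equivalence.to (iso (# 0) (# 3)) (s≤s (s≤s z≤n)))
    (Equivalence.to (iso (# 3) (# 1)) (s≤s (s≤s (s≤s z≤n))))

separable⇒avoids-3142 : ∀ {m} (w : Word m m) → Separable (entries w) → Avoids w p3142
separable⇒avoids-3142 w sep (p@(_ ∷ _ ∷ _ ∷ _ ∷ []) , inc , iso) =
  sep down (positions⇒sublist (toℕ ∘ lookup w) p inc)
    (Equivalence.to (iso (# 0) (# 2)) (s≤s (s≤s (s≤s z≤n))))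
    (Equivalence.to (iso (# 3) (# 0)) (s≤s (s≤s z≤n)))
    (Equivalence.to (iso (# 1) (# 3)) (s≤s z≤n))

-- Counting permutations by trees

record Admissible (m : ℕ) (xs : List ℕ) : Set where
  constructor admissible
  field
    isInterval    : Interval 0 m xs
    isSeparable   : Separable xs
    isAlternating : Alternating up xs

𝔄⇒admissible : ∀ {m} (w : Word m m) → 𝔄 m w → Admissible m (entries w)
𝔄⇒admissible w (perm , ud , av₁ , av₂) =
  admissible (permutation⇒interval w perm) (avoids⇒separable w av₁ av₂) (upDown⇒alternating w ud)

admissible⇒𝔄 : ∀ {m} (w : Word m m) → Admissible m (entries w) → 𝔄 m w
admissible⇒𝔄 w (admissible i sep alt) =
  interval⇒permutation w i , alternating⇒upDown w alt , separable⇒avoids-2413 w sep , separable⇒avoids-3142 w sep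

-- Permutations and trees are compared through the lists they describe: the two images are free of
-- repetitions and have the same members, hence the same length.
count : ∀ m {A : Set} (ts : List A) (f : A → List ℕ) → Unique ts → (∀ {x y} → f x ≡ f y → x ≡ y) →
  (∀ {x} → x ∈ ts → Admissible m (f x)) → (∀ {xs} → Admissible m xs → ∃ λ x → x ∈ ts × f x ≡ xs) →
  ∣𝔄∣ m ≡ length ts
count m ts f uniq inj sound exhaustive = trans (sym (length-map entries (𝔄-list m)))
  (trans (Unique-length (Unique.map⁺ entries-injective (𝔄-list-unique m)) (Unique.map⁺ inj uniq) sub sup)
    (length-map f ts))
  where
  sub : ∀ {xs} → xs ∈ map entries (𝔄-list m) → xs ∈ map f ts
  sub {xs} p =
    let w , w∈ , eq  = ∈-map⁻ entries p
        x , x∈ , eq′ = exhaustive (𝔄⇒admissible w (Equivalence.to (∈-𝔄-list w) w∈))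
    in subst (_∈ map f ts) (trans eq′ (sym eq)) (∈-map⁺ f x∈)
  sup : ∀ {xs} → xs ∈ map f ts → xs ∈ map entries (𝔄-list m)
  sup {xs} p =
    let x , x∈ , eq = ∈-map⁻ f p
        adm         = sound x∈
        w , eq′     = entries-surjective (Admissible.isInterval adm)
        w∈          = Equivalence.from (∈-𝔄-list w) (admissible⇒𝔄 w (subst (Admissible m) (sym eq′) adm))
    in subst (_∈ map entries (𝔄-list m)) (trans eq′ (sym eq)) (∈-map⁺ entries w∈)

after-even : ∀ n s xs → length xs ≡ n + n → after s xs ≡ s
after-even zero    s []           eq = refl
after-even (suc n) s (x ∷ [])     eq rewrite +-suc n n with () ← eq
after-even (suc n) s (x ∷ y ∷ xs) eq rewrite +-suc n n | flip-involutive s =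
  after-even n s xs (suc-injective (suc-injective eq))

admissible⇒valid : ∀ {m xs} → Admissible m xs → Valid up 0 xs
admissible⇒valid {xs = xs} (admissible i sep alt) =
  mkValid (subst (λ k → Interval 0 k xs) (sym (Interval-length i)) i) sep alt

r≡diag : ∀ n → r n ≡ diag 1 n
r≡diag n = trans (count (2 * n + 1) (forests 1 1 n) list (forests-unique 1 1 n) injective sound exhaustive)
  (length-forests 1 1 n)
  where
  list : Forest 1 1 → List ℕ
  list (a ∷ [] , l ∷ []) = Layout.place (oddLayout up a l) 0
  injective : ∀ {f g} → list f ≡ list g → f ≡ g
  injective {a ∷ [] , l ∷ []} {a′ ∷ [] , l′ ∷ []} eq with odd-injective up a l a′ l′ 0 0 eq
  ... | refl , refl = refl
  layoutSize : ∀ a l → Layout.size (oddLayout up a l) ≡ 2 * weight (a ∷ [] , l ∷ []) + 1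
  layoutSize a l rewrite block-size up a | chain-size down l = arith (weightᴮ a) (weightᶜ l)
    where
    arith : ∀ a l → suc (2 * a) + 2 * l ≡ 2 * (a + 0 + (l + 0)) + 1
    arith = solve-∀
  sound : ∀ {f} → f ∈ forests 1 1 n → Admissible (2 * n + 1) (list f)
  sound {a ∷ [] , l ∷ []} f∈ = admissible
    (subst (λ k → Interval 0 k (list (a ∷ [] , l ∷ [])))
      (trans (layoutSize a l) (cong (λ e → 2 * e + 1) (All.lookup (forests-weight 1 1 n) f∈)))
      (Layout.valid (oddLayout up a l) 0))
    (Good.separable (odd-good up a l 0)) (Good.alternating (odd-good up a l 0))
  odd : ∀ n → 2 * n + 1 ≡ suc (n + n)
  odd = solve-∀
  isOdd : ∀ xs → length xs ≡ suc (n + n) → after up xs ≡ down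
  isOdd (x ∷ xs) eq = after-even n down xs (suc-injective eq)
  exhaustive : ∀ {xs} → Admissible (2 * n + 1) xs → ∃ λ f → f ∈ forests 1 1 n × list f ≡ xs
  exhaustive {xs} adm =
    let len        = Interval-length (Admissible.isInterval adm)
        a , l , eq = parseOdd (length xs) up ≤-refl (admissible⇒valid adm) (isOdd xs (trans len (odd n)))
        size≡      = trans (sym (Interval-length (Layout.valid (oddLayout up a l) 0))) (trans (cong length eq) len)
        weight≡    = *-cancelˡ-≡ _ n 2 (+-cancelʳ-≡ 1 _ _ (trans (sym (layoutSize a l)) size≡))
    in (a ∷ [] , l ∷ []) , forests-complete n _ weight≡ , eq

-- A nonempty list of even length is some `cons a b l m`. The root accounts for the step from `n` to
-- `suc n`, the factor x in T = x S²; the two blocks and two chains are a forest counted by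
-- `diag 2 n`.
t≡diag : ∀ n → t (suc n) ≡ diag 2 n
t≡diag n = trans (count (2 * suc n) (forests 2 2 n) list (forests-unique 2 2 n) injective sound exhaustive)
  (length-forests 2 2 n)
  where
  list : Forest 2 2 → List ℕ
  list (a ∷ b ∷ [] , l ∷ m ∷ []) = Layout.place (chainLayout up (cons a b l m)) 0
  injective : ∀ {f g} → list f ≡ list g → f ≡ g
  injective {a ∷ b ∷ [] , l ∷ m ∷ []} {a′ ∷ b′ ∷ [] , l′ ∷ m′ ∷ []} eq
    with chain-injective up (cons a b l m) (cons a′ b′ l′ m′) 0 0 eq
  ... | refl = refl
  layoutSize : ∀ a b l m →
    Layout.size (chainLayout up (cons a b l m)) ≡ 2 * suc (weight (a ∷ b ∷ [] , l ∷ m ∷ []))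
  layoutSize a b l m = trans (chain-size up (cons a b l m))
    (arith (weightᴮ a) (weightᴮ b) (weightᶜ l) (weightᶜ m))
    where
    arith : ∀ a b l m → 2 * suc (a + b + l + m) ≡ 2 * suc (a + (b + 0) + (l + (m + 0)))
    arith = solve-∀
  sound : ∀ {f} → f ∈ forests 2 2 n → Admissible (2 * suc n) (list f)
  sound {a ∷ b ∷ [] , l ∷ m ∷ []} f∈ = admissible
    (subst (λ k → Interval 0 k (list (a ∷ b ∷ [] , l ∷ m ∷ [])))
      (trans (layoutSize a b l m) (cong (λ e → 2 * suc e) (All.lookup (forests-weight 2 2 n) f∈)))
      (Layout.valid (chainLayout up (cons a b l m)) 0))
    (Good.separable (chain-good up (cons a b l m) 0)) (Good.alternating (chain-good up (cons a b l m) 0))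
  exhaustive : ∀ {xs} → Admissible (2 * suc n) xs → ∃ λ f → f ∈ forests 2 2 n × list f ≡ xs
  exhaustive {xs} adm =
    let l , eq = parseChain (length xs) up ≤-refl (admissible⇒valid adm)
                   (after-even (suc n) up xs (trans len (cong (suc n +_) (+-identityʳ (suc n)))))
    in finish l eq
    where
    len : length xs ≡ 2 * suc n
    len = Interval-length (Admissible.isInterval adm)
    finish : ∀ l → Layout.place (chainLayout up l) 0 ≡ xs → ∃ λ f → f ∈ forests 2 2 n × list f ≡ xs
    finish nil            eq with () ← trans (cong length eq) len
    finish (cons a b l m) eq =
      let size≡   = trans (sym (Interval-length (Layout.valid (chainLayout up (cons a b l m)) 0)))
                      (trans (cong length eq) len)
          weight≡ = suc-injective (*-cancelˡ-≡ _ (suc n) 2 (trans (sym (layoutSize a b l m)) size≡))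
      in (a ∷ b ∷ [] , l ∷ m ∷ []) , forests-complete n _ weight≡ , eq

theorem6p2 : (½ · R ≈ ½ · (R ⊗ T) ⊕ T) ×
    (t 1 ≡ 1) ×
    ((n : ℕ) (2≤n : 2 ≤ n) → fromℕ (t n) ≡ closedForm n 2≤n)
-- The number `diag 2 0` evaluates to 1.
theorem6p2 = functional , t≡diag 0 , closed
  where
  open ≡-Reasoning
  R≡ : ∀ n → R n ≡ fromℕ (dropConstant (diag 1) n)
  R≡ zero    = refl
  R≡ (suc n) = cong fromℕ (r≡diag (suc n))
  T≡ : ∀ n → T n ≡ fromℕ (shift (diag 2) n)
  T≡ zero    = refl
  T≡ (suc n) = cong fromℕ (t≡diag n)
  R⊗T : ℕ → ℕ
  R⊗T = conv (dropConstant (diag 1)) (shift (diag 2))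
  functional : ½ · R ≈ ½ · (R ⊗ T) ⊕ T
  functional zero    = refl
  functional (suc n) = begin
    ½ ℚ.* R (suc n)
      ≡⟨ cong (½ ℚ.*_) (trans (R≡ (suc n)) (cong fromℕ (diag-relation n))) ⟩
    ½ ℚ.* fromℕ (R⊗T (suc n) + (diag 2 n + diag 2 n))
      ≡⟨ cong (½ ℚ.*_) (trans (fromℕ-+ (R⊗T (suc n)) _)
           (cong (fromℕ (R⊗T (suc n)) ℚ.+_) (fromℕ-+ (diag 2 n) (diag 2 n)))) ⟩
    ½ ℚ.* (fromℕ (R⊗T (suc n)) ℚ.+ (fromℕ (diag 2 n) ℚ.+ fromℕ (diag 2 n)))
      ≡⟨ ½-double (fromℕ (R⊗T (suc n))) (fromℕ (diag 2 n)) ⟩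
    ½ ℚ.* fromℕ (R⊗T (suc n)) ℚ.+ fromℕ (diag 2 n)
      ≡⟨ cong₂ (λ a b → ½ ℚ.* a ℚ.+ b)
           (⊗-fromℕ (dropConstant (diag 1)) (shift (diag 2)) R≡ T≡ (suc n)) (T≡ (suc n)) ⟨
    ½ ℚ.* (R ⊗ T) (suc n) ℚ.+ T (suc n) ∎
  closed : (n : ℕ) (2≤n : 2 ≤ n) → fromℕ (t n) ≡ closedForm n 2≤n
  closed (suc (suc m)) (s≤s (s≤s z≤n)) = begin
    fromℕ (t (2 + m))
      ≡⟨ cong fromℕ (t≡diag (suc m)) ⟩
    fromℕ (diag 2 (suc m))
      ≡⟨ fromℕ-quotient m 4 (diag 2 (suc m)) (sumBelow (suc m) (summand (2 + m))) (diag2-closed m) ⟩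
    (pos 4 ℚ./ suc m) ℚ.* fromℕ (sumBelow (suc m) (summand (2 + m)))
      ≡⟨ cong ((pos 4 ℚ./ suc m) ℚ.*_) (∑-fromℕ m (fromℕ ∘ summand (2 + m)) (summand (2 + m)) (λ _ → refl)) ⟨
    closedForm (2 + m) (s≤s (s≤s z≤n)) ∎
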